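{- For every subsemigroup $D$ of $(\mathbb{N}_0,+)$, the set $\mathcal I_D$ is a category of partitions.
   Context: A (two-colored) partition $p$ consists of two finite totally ordered sets $U$ (upper row, ordered left to right) and $L$ (lower row), a decomposition of the disjoint union $U\sqcup L$ (the points of $p$) into non-empty pairwise disjoint subsets (blocks), and a coloring of every point by white $\circ$ or black $\bullet$. A pair partition is one all of whose blocks have exactly two points. Operations: the tensor product $p\otimes p'$ appends each row of $p'$ to the right of the corresponding row of $p$; the involution $p^*$ exchanges upper and lower row; if the lower row of $p'$ and the upper row of $p$ agree in length and coloring, the composition $pp'$ is obtained by placing $p'$ on top of $p$, identifying the lower row of $p'$ with the upper row of $p$, taking the upper row of $p'$ as upper row and the lower row of $p$ as lower row, and declaring two remaining points to lie in the same block iff they are connected through blocks of $p$ and $p'$ via the identified middle points (components lying entirely in the middle are discarded). A category of partitions is a set of partitions closed under tensor products, compositions (whenever defined) and involution, and containing the two partitions with one upper and one lower point, both of the same color $c\in\{\circ,\bullet\}$, forming one block, and the two partitions with empty upper row and lower row $\circ\bullet$ resp. $\bullet\circ$ whose two points form one block. Cyclic order and color sum: on the points of $p$ consider the cyclic order obtained by traversing the lower row from left to right, then the upper row from right to left, then returning to the leftmost lower point. For points $\alpha,\beta$, $]\alpha,\beta[$ denotes the set of points strictly after $\alpha$ and strictly before $\beta$ in this cyclic order, and $]\alpha,\beta]:=]\alpha,\beta[\cup\{\beta\}$ if $\alpha\ne\beta$, $]\alpha,\alpha]:=\emptyset$. The normalized color of a lower point is its color, that of an upper point the opposite color. For a set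 $S$ of points, $\sigma_p(S)$ is the number of points of normalized color $\circ$ in $S$ minus the number of points of normalized color $\bullet$ in $S$. Two distinct blocks $B,B'$ cross if there are points $\alpha,\beta\in B$, $\gamma,\delta\in B'$ occurring in the cyclic order in the order $\alpha,\gamma,\beta,\delta$. $\mathcal P^{\circ\bullet}_{2,\mathrm{nb}}$ is the set of pair partitions each of whose blocks contains one point of normalized color $\circ$ and one of normalized color $\bullet$. $\mathcal S_0$ is the set of $p\in\mathcal P^{\circ\bullet}_{2,\mathrm{nb}}$ such that $\sigma_p(]\alpha,\beta[)=0$ for every block $\{\alpha,\beta\}$ of $p$. For $p\in\mathcal S_0$ and points $\alpha,\beta$ put $\delta_p(\alpha,\beta)=\sigma_p(]\alpha,\beta[)$ if $\alpha,\beta$ have different normalized colors and $\delta_p(\alpha,\beta)=\sigma_p(]\alpha,\beta])$ otherwise; for blocks $B,B'$ of $p\in\mathcal S_0$ the value $\delta_p(\alpha,\alpha')$ is independent of the choice $\alpha\in B,\alpha'\in B'$, and $d_p(B,B'):=|\delta_p(\alpha,\alpha')|$. A subsemigroup of $(\mathbb N_0,+)$ is a (possibly empty) subset closed under addition. For such $D$, $\mathcal I_D$ is the set of all $p\in\mathcal S_0$ such that $d_p(B,B')\notin D$ for all pairs of crossing blocks $B,B'$ of $p$. -}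

module Defs where

open import Data.Bool.Base using (if_then_else_)
open import Data.Fin.Base using (Fin; toℕ; opposite; splitAt)
import Data.Fin.Properties as Fin
open import Data.Integer.Base using (ℤ; 0ℤ; _⊖_; ∣_∣)
open import Data.List.Base as List using (List; []; _∷_; allFin; filter; length)
open import Data.List.Membership.Propositional using (_∈_)
import Data.List.Membership.Propositional.Properties as ∈
open import Data.List.Relation.Unary.Any using (here; there)
open import Data.Nat.Base using (ℕ; _+_; _<_)
import Data.Nat.Properties as ℕ
open import Data.Product.Base using (∃; _×_; _,_)
open import Data.Sum.Base using (_⊎_; inj₁; inj₂; swap) renaming (map to map-⊎)
import Data.Sum.Properties as Sum
open import Data.Sum.Relation.Binary.Pointwise using (Pointwise; ⊎-isDecEquivalence)
open import Data.Vec.Base using (Vec; []; _∷_; _++_; lookup)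
open import Function.Base using (_on_)
open import Function.Bundles using (_⇔_)
open import Level using (Level; 0ℓ; _⊔_) renaming (suc to lsuc)
open import Relation.Binary.Construct.Always using (Always)
import Relation.Binary.Construct.Always as Always
open import Relation.Binary.Construct.Closure.Equivalence using (EqClosure)
import Relation.Binary.Construct.Closure.Equivalence as EqC
open import Relation.Binary.Construct.Closure.ReflexiveTransitive using (Star; ε; _◅_; _◅◅_)
open import Relation.Binary.Construct.Closure.Symmetric using (SymClosure; fwd; bwd)
import Relation.Binary.Construct.On as On
open import Relation.Binary.Core using (Rel)
open import Relation.Binary.Definitions using (Decidable; DecidableEquality)
open import Relation.Binary.PropositionalEquality using (_≡_; _≢_; refl)
open import Relation.Binary.Structures using (IsDecEquivalence)
open import Relation.Nullary.Decidable using (yes; no; does; map′; _×-dec_; _⊎-dec_; ¬?)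
open import Relation.Nullary.Negation using (¬_)
open import Relation.Unary using (Pred) renaming (Decidable to Decidable₁; _∉_ to _∉ₚ_; _∈_ to _∈ₚ_)

private
  variable
    a ℓ c : Level
    k k′ l l′ m : ℕ

-- Decidability of connectedness in finite graphs (Warshall's algorithm).
module _ {A : Set a} {R : Rel A ℓ}
         (_≟_ : DecidableEquality A) (R? : Decidable R) where

  private
    -- A path from x to y whose interior vertices all lie in the list.
    Via : List A → Rel A (a ⊔ ℓ)
    Via []       x y = x ≡ y ⊎ R x y
    Via (v ∷ vs) x y = Via vs x y ⊎ (Via vs x v × Via vs v y)

    via? : ∀ vs → Decidable (Via vs)
    via? []       x y = (x ≟ y) ⊎-dec R? x y
    via? (v ∷ vs) x y = via? vs x y ⊎-dec (via? vs x v ×-dec via? vs v y)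

    edge : ∀ vs {x y} → x ≡ y ⊎ R x y → Via vs x y
    edge []       e = e
    edge (v ∷ vs) e = inj₁ (edge vs e)

    sound : ∀ vs {x y} → Via vs x y → Star R x y
    sound []       (inj₁ refl)    = ε
    sound []       (inj₂ r)       = r ◅ ε
    sound (v ∷ vs) (inj₁ p)       = sound vs p
    sound (v ∷ vs) (inj₂ (p , q)) = sound vs p ◅◅ sound vs q

    join : ∀ vs {x y z} → z ∈ vs → Via vs x z → Via vs z y → Via vs x y
    join (v ∷ vs) (here refl) (inj₁ p)       (inj₁ q)        = inj₂ (p , q)
    join (v ∷ vs) (here refl) (inj₁ p)       (inj₂ (_ , q))  = inj₂ (p , q)
    join (v ∷ vs) (here refl) (inj₂ (p , _)) (inj₁ q)        = inj₂ (p , q)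
    join (v ∷ vs) (here refl) (inj₂ (p , _)) (inj₂ (_ , q))  = inj₂ (p , q)
    join (v ∷ vs) (there z∈)  (inj₁ p)       (inj₁ q)        = inj₁ (join vs z∈ p q)
    join (v ∷ vs) (there z∈)  (inj₁ p)       (inj₂ (q , q′)) = inj₂ (join vs z∈ p q , q′)
    join (v ∷ vs) (there z∈)  (inj₂ (p , p′)) (inj₁ q)       = inj₂ (p , join vs z∈ p′ q)
    join (v ∷ vs) (there z∈)  (inj₂ (p , _)) (inj₂ (_ , q))  = inj₂ (p , q)

  star? : ∀ {vs} → (∀ x → x ∈ vs) → Decidable (Star R)
  star? {vs} all∈ x y = map′ (sound vs) complete (via? vs x y)
    where
    complete : ∀ {x y} → Star R x y → Via vs x y
    complete ε        = edge vs (inj₁ refl)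
    complete (r ◅ rs) = join vs (all∈ _) (edge vs (inj₂ r)) (complete rs)

data Color : Set where
  ○ ● : Color

_≟ᶜ_ : DecidableEquality Color
○ ≟ᶜ ○ = yes refl
○ ≟ᶜ ● = no λ ()
● ≟ᶜ ○ = no λ ()
● ≟ᶜ ● = yes refl

flip : Color → Color
flip ○ = ●
flip ● = ○

Point : ℕ → ℕ → Set
Point k l = Fin k ⊎ Fin l

pattern upper i = inj₁ i
pattern lower j = inj₂ j

_≟ᵖ_ : DecidableEquality (Point k l)
_≟ᵖ_ = Sum.≡-dec Fin._≟_ Fin._≟_

points : ∀ k l → List (Point k l)
points k l = List.map inj₁ (allFin k) List.++ List.map inj₂ (allFin l)

∈-points : (α : Point k l) → α ∈ points k l
∈-points         (upper i) = ∈.∈-++⁺ˡ (∈.∈-map⁺ inj₁ (∈.∈-allFin i))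
∈-points {k = k} (lower j) =
  ∈.∈-++⁺ʳ (List.map inj₁ (allFin k)) (∈.∈-map⁺ inj₂ (∈.∈-allFin j))

-- U colors the upper row and L the lower row.
-- The blocks are the classes of the equivalence relation _∼_, and a
-- point also serves as a name for the block containing it.
record Partition (U : Vec Color k) (L : Vec Color l) : Set₁ where
  field
    _∼_              : Rel (Point k l) 0ℓ
    isDecEquivalence : IsDecEquivalence _∼_

  open IsDecEquivalence isDecEquivalence public
    using () renaming (_≟_ to _∼?_; refl to ∼-refl; sym to ∼-sym; trans to ∼-trans)

_[_∼_] : {U : Vec Color k} {L : Vec Color l} → Partition U L → Rel (Point k l) 0ℓ
p [ α ∼ β ] = Partition._∼_ p α β

_≈_ : {U : Vec Color k} {L : Vec Color l} → Rel (Partition U L) 0ℓ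
p ≈ q = ∀ α β → p [ α ∼ β ] ⇔ q [ α ∼ β ]

oneBlock : (U : Vec Color k) (L : Vec Color l) → Partition U L
oneBlock U L = record
  { _∼_              = Always
  ; isDecEquivalence = record
    { isEquivalence = Always.isEquivalence _ _
    ; _≟_           = λ _ _ → yes _
    }
  }

splitPoint : ∀ k l → Point (k + k′) (l + l′) → Point k l ⊎ Point k′ l′
splitPoint k l (upper i) = map-⊎ inj₁ inj₁ (splitAt k i)
splitPoint k l (lower j) = map-⊎ inj₂ inj₂ (splitAt l j)

infixr 6 _⊗_
_⊗_ : {U : Vec Color k} {L : Vec Color l} {U′ : Vec Color k′} {L′ : Vec Color l′} →
      Partition U L → Partition U′ L′ → Partition (U ++ U′) (L ++ L′)
_⊗_ {k = k} {l = l} p p′ = record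
  { _∼_              = Pointwise (Partition._∼_ p) (Partition._∼_ p′) on splitPoint k l
  ; isDecEquivalence = On.isDecEquivalence (splitPoint k l)
      (⊎-isDecEquivalence (Partition.isDecEquivalence p) (Partition.isDecEquivalence p′))
  }

infix 8 _*
_* : {U : Vec Color k} {L : Vec Color l} → Partition U L → Partition L U
p * = record
  { _∼_              = Partition._∼_ p on swap
  ; isDecEquivalence = On.isDecEquivalence swap (Partition.isDecEquivalence p)
  }

module Composition {U : Vec Color k} {M : Vec Color m} {L : Vec Color l}
                   (p : Partition M L) (p′ : Partition U M) where

  -- p′ is placed on top of p; glue identifies their middle rows.
  Vertex : Set
  Vertex = Point k m ⊎ Point m l

  data Edge : Rel Vertex 0ℓ where
    top    : ∀ {α β} → p′ [ α ∼ β ] → Edge (inj₁ α) (inj₁ β)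
    bottom : ∀ {α β} → p [ α ∼ β ] → Edge (inj₂ α) (inj₂ β)
    glue   : ∀ i → Edge (inj₁ (lower i)) (inj₂ (upper i))

  Connected : Rel Vertex 0ℓ
  Connected = EqClosure Edge

  edge? : Decidable Edge
  edge? (inj₁ α) (inj₁ β) = map′ top (λ { (top r) → r }) (Partition._∼?_ p′ α β)
  edge? (inj₂ α) (inj₂ β) = map′ bottom (λ { (bottom r) → r }) (Partition._∼?_ p α β)
  edge? (inj₁ (lower i)) (inj₂ (upper j)) =
    map′ (λ { refl → glue i }) (λ { (glue _) → refl }) (i Fin.≟ j)
  edge? (inj₁ (upper _)) (inj₂ _)         = no λ ()
  edge? (inj₁ (lower _)) (inj₂ (lower _)) = no λ ()
  edge? (inj₂ _)         (inj₁ _)         = no λ ()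

  connected? : Decidable Connected
  connected? = star? (Sum.≡-dec _≟ᵖ_ _≟ᵖ_) symEdge? vertex∈
    where
    symEdge? : Decidable (SymClosure Edge)
    symEdge? x y = map′ (λ { (inj₁ e) → fwd e ; (inj₂ e) → bwd e })
                        (λ { (fwd e) → inj₁ e ; (bwd e) → inj₂ e })
                        (edge? x y ⊎-dec edge? y x)

    vertex∈ : ∀ v → v ∈ List.map inj₁ (points k m) List.++ List.map inj₂ (points m l)
    vertex∈ (inj₁ α) = ∈.∈-++⁺ˡ (∈.∈-map⁺ inj₁ (∈-points α))
    vertex∈ (inj₂ α) =
      ∈.∈-++⁺ʳ (List.map inj₁ (points k m)) (∈.∈-map⁺ inj₂ (∈-points α))

  outer : Point k l → Vertex
  outer (upper i) = inj₁ (upper i)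
  outer (lower j) = inj₂ (lower j)

  composite : Partition U L
  composite = record
    { _∼_              = Connected on outer
    ; isDecEquivalence = On.isDecEquivalence outer record
      { isEquivalence = EqC.isEquivalence Edge
      ; _≟_           = connected?
      }
    }

infixr 7 _∙_
_∙_ : {U : Vec Color k} {M : Vec Color m} {L : Vec Color l} →
      Partition M L → Partition U M → Partition U L
p ∙ p′ = Composition.composite p p′

PartitionSet : ∀ c → Set (lsuc 0ℓ ⊔ lsuc c)
PartitionSet c = ∀ {k l} {U : Vec Color k} {L : Vec Color l} → Partition U L → Set c

record IsCategory (C : PartitionSet c) : Set (lsuc 0ℓ ⊔ c) where
  field
    -- C is a set of partitions, i.e. invariant under equality of partitions.
    resp-≈ : ∀ {k l} {U : Vec Color k} {L : Vec Color l} {p q : Partition U L} →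
             p ≈ q → C p → C q

    ⊗-closed : ∀ {k l k′ l′} {U : Vec Color k} {L : Vec Color l}
               {U′ : Vec Color k′} {L′ : Vec Color l′}
               {p : Partition U L} {p′ : Partition U′ L′} →
               C p → C p′ → C (p ⊗ p′)

    ∙-closed : ∀ {k m l} {U : Vec Color k} {M : Vec Color m} {L : Vec Color l}
               {p : Partition M L} {p′ : Partition U M} →
               C p → C p′ → C (p ∙ p′)

    *-closed : ∀ {k l} {U : Vec Color k} {L : Vec Color l} {p : Partition U L} →
               C p → C (p *)

    identity : ∀ x → C (oneBlock (x ∷ []) (x ∷ []))
    pair-○●  : C (oneBlock [] (○ ∷ ● ∷ []))
    pair-●○  : C (oneBlock [] (● ∷ ○ ∷ []))

-- Position in the traversal of the lower row from left to right
-- followed by the upper row from right to left.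
position : Point k l → ℕ
position         (lower j) = toℕ j
position {l = l} (upper i) = l + toℕ (opposite i)

-- The points strictly after α and strictly before β in the cyclic order
-- (by convention none if α ≡ β).
]_,_[ : Point k l → Point k l → Pred (Point k l) 0ℓ
] α , β [ γ = (position α < position γ × position γ < position β)
            ⊎ (position γ < position β × position β < position α)
            ⊎ (position β < position α × position α < position γ)

]_,_] : Point k l → Point k l → Pred (Point k l) 0ℓ
] α , β ] γ = α ≢ β × (] α , β [ γ ⊎ γ ≡ β)

open? : (α β : Point k l) → Decidable₁ ] α , β [
open? α β γ = (position α ℕ.<? position γ ×-dec position γ ℕ.<? position β)
        ⊎-dec (position γ ℕ.<? position β ×-dec position β ℕ.<? position α)
        ⊎-dec (position β ℕ.<? position α ×-dec position α ℕ.<? position γ)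

halfOpen? : (α β : Point k l) → Decidable₁ ] α , β ]
halfOpen? α β γ = ¬? (α ≟ᵖ β) ×-dec (open? α β γ ⊎-dec (γ ≟ᵖ β))

module _ {U : Vec Color k} {L : Vec Color l} (p : Partition U L) where

  normColor : Point k l → Color
  normColor (upper i) = flip (lookup U i)
  normColor (lower j) = lookup L j

  count : {S : Pred (Point k l) ℓ} → Decidable₁ S → Color → ℕ
  count S? x = length (filter (λ α → S? α ×-dec (normColor α ≟ᶜ x)) (points k l))

  σ : {S : Pred (Point k l) ℓ} → Decidable₁ S → ℤ
  σ S? = count S? ○ ⊖ count S? ●

  δ : Point k l → Point k l → ℤ
  δ α β = if does (normColor α ≟ᶜ normColor β)
          then σ (halfOpen? α β)
          else σ (open? α β)

  -- Distance between the blocks of α and β; for partitions in 𝓢₀ it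
  -- does not depend on the points chosen to name the blocks.
  d : Point k l → Point k l → ℕ
  d α β = ∣ δ α β ∣

  Cross : Rel (Point k l) 0ℓ
  Cross b b′ = ¬ p [ b ∼ b′ ] ×
    ∃ λ α → ∃ λ β → ∃ λ γ → ∃ λ δ →
      p [ b ∼ α ] × p [ b ∼ β ] × p [ b′ ∼ γ ] × p [ b′ ∼ δ ] ×
      ] α , β [ γ × ] β , α [ δ

  PairBlock : Rel (Point k l) 0ℓ
  PairBlock α β = α ≢ β × (∀ γ → p [ α ∼ γ ] ⇔ (γ ≡ α ⊎ γ ≡ β))

  IsPairPartition : Set
  IsPairPartition = ∀ α → ∃ λ β → PairBlock α β

record 𝓟₂,nb {U : Vec Color k} {L : Vec Color l} (p : Partition U L) : Set where
  field
    isPair  : IsPairPartition p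
    neutral : ∀ {α β} → PairBlock p α β → normColor p α ≢ normColor p β

record 𝓢₀ {U : Vec Color k} {L : Vec Color l} (p : Partition U L) : Set where
  field
    in-𝓟₂,nb : 𝓟₂,nb p
    balanced : ∀ {α β} → PairBlock p α β → σ p (open? α β) ≡ 0ℤ

record IsSubsemigroup (D : Pred ℕ ℓ) : Set ℓ where
  field
    +-closed : ∀ {m n} → m ∈ₚ D → n ∈ₚ D → m + n ∈ₚ D

record 𝓘 (D : Pred ℕ ℓ) {U : Vec Color k} {L : Vec Color l} (p : Partition U L) : Set ℓ where
  field
    in-𝓢₀   : 𝓢₀ p
    avoids-D : ∀ {b b′} → Cross p b b′ → d p b b′ ∉ₚ D

{-# OPTIONS --safe #-}
module Submission where

-- Reading each row from left to right as a path with steps ±1 (○ up, ● down)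
-- gives every point a level, and δ p α β = level β - level α whenever both rows
-- have the same color sum.  So p lies in 𝓢₀ iff all blocks are neutral pairs of
-- points of equal level, and d is the distance of levels.  Levels depend only on
-- the row, so under composition they agree on the glued points and are constant
-- along the path that forms a block of p ∙ p′.
--
-- If two blocks of p ∙ p′ cross, then some block of p or p′ on the path of one
-- crosses some block on the path of the other, at the same distance.  Otherwise,
-- give each point on the path of b′ its sign and every other point weight zero.
-- The prefix sums of these weights along the rows are constant along the path of
-- b, because no block on it separates a pair of cancelling weights.  Hence the
-- weights on an arc between the two ends of b sum to zero, although exactly one
-- end of b′ lies on it.

open import Defs
import Algebra.Properties.AbelianGroup
import Algebra.Properties.CommutativeMonoid.Sum
open import Data.Bool.Base using (Bool; true; false)
open import Data.Empty using (⊥)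
open import Data.Fin.Base as Fin using (Fin; zero; suc; toℕ; opposite; splitAt; join; _↑ˡ_; _↑ʳ_)
import Data.Fin.Properties as Fin
open import Data.Fin.Permutation using (permutation)
open import Data.Integer.Base using (ℤ; 0ℤ; 1ℤ; -1ℤ; +_; -_; ∣_∣; _+_; _-_)
import Data.Integer.Properties as ℤ
open import Data.Integer.Tactic.RingSolver using (solve-∀)
open import Data.List.Base as List using (List; []; _∷_; filter; length; tabulate)
open import Data.List.Properties using (map-tabulate)
open import Data.Nat.Base as ℕ using (ℕ; zero; suc)
import Data.Nat.Properties as ℕ
open import Data.Product.Base using (∃; _×_; _,_; proj₁; proj₂)
open import Data.Sum.Base using (_⊎_; inj₁; inj₂; swap; [_,_]′) renaming (map to map-⊎)
open import Data.Sum.Properties using (≡-dec; inj₁-injective; inj₂-injective)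
open import Data.Sum.Relation.Binary.Pointwise using (Pointwise; inj₁; inj₂)
open import Data.Unit.Base using (⊤; tt)
open import Data.Vec.Base using (Vec; []; _∷_; _++_; lookup)
open import Data.Vec.Properties using (lookup-++ˡ; lookup-++ʳ)
open import Function.Base using (_∘_; id)
open import Function.Bundles using (_⇔_; mk⇔; Equivalence)
open import Level using (Level; 0ℓ)
import Relation.Binary.Construct.Closure.Equivalence as EqC
open import Relation.Binary.Construct.Closure.ReflexiveTransitive using (ε; _◅_; _◅◅_)
open import Relation.Binary.Construct.Closure.Symmetric using (fwd; bwd)
open import Relation.Binary.Core using (Rel)
open import Relation.Binary.Definitions using (Decidable; Trichotomous; tri<; tri≈; tri>)
open import Relation.Binary.PropositionalEquality
  using (_≡_; _≢_; _≗_; refl; sym; trans; cong; cong₂; subst; subst₂; module ≡-Reasoning)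
open import Relation.Nullary.Decidable
  using (Dec; yes; no; does; _×-dec_; _⊎-dec_; does-⇔; dec-true; dec-false; toSum; decidable-stable)
open import Relation.Nullary.Negation using (¬_; contradiction)
open import Relation.Unary using (Pred) renaming (Decidable to Decidable₁)

private
  variable
    k l m n k′ l′ : ℕ
    ℓ : Level

module Sum = Algebra.Properties.CommutativeMonoid.Sum ℤ.+-0-commutativeMonoid
open Sum using (sum)
open Algebra.Properties.AbelianGroup ℤ.+-0-abelianGroup using (identityˡ-unique)

-- Sums over points

infixr 8 _⋆_
-- Sums over a set of points are written as sums over all points with an indicator, so that sums
-- over different sets can be compared pointwise.
_⋆_ : Bool → ℤ → ℤ
true  ⋆ x = x
false ⋆ x = 0ℤ

⋆-zero : ∀ b → b ⋆ 0ℤ ≡ 0ℤ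
⋆-zero true  = refl
⋆-zero false = refl

⋆-neg : ∀ b x → b ⋆ (- x) ≡ - (b ⋆ x)
⋆-neg true  x = refl
⋆-neg false x = refl

sum-zero : (f : Fin n → ℤ) → (∀ i → f i ≡ 0ℤ) → sum f ≡ 0ℤ
sum-zero {n} f f≡0 = trans (Sum.sum-cong-≗ f≡0) (Sum.sum-replicate-zero n)

sum-neg : (f : Fin n → ℤ) → sum (λ i → - f i) ≡ - sum f
sum-neg {zero}  f = refl
sum-neg {suc n} f = trans (cong (λ s → - f zero + s) (sum-neg (f ∘ suc)))
                          (sym (ℤ.neg-distrib-+ (f zero) (sum (f ∘ suc))))

sum-single : (f : Fin n → ℤ) (i : Fin n) → sum (λ j → does (j Fin.≟ i) ⋆ f j) ≡ f i
sum-single f zero    = trans (cong (λ s → f zero + s) (sum-zero (λ j → does (suc j Fin.≟ zero) ⋆ f (suc j)) λ _ → refl)) (ℤ.+-identityʳ _)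
sum-single f (suc i) = trans (ℤ.+-identityˡ _) (sum-single (f ∘ suc) i)

prefixSum : (Fin n → ℤ) → Fin n → ℤ
prefixSum f zero    = 0ℤ
prefixSum f (suc i) = f zero + prefixSum (f ∘ suc) i

sum-< : (f : Fin n → ℤ) (i : Fin n) → sum (λ j → does (j Fin.<? i) ⋆ f j) ≡ prefixSum f i
sum-< {suc n} f zero = sum-zero {suc n} (λ _ → 0ℤ) λ _ → refl
sum-< f (suc i) = cong (λ s → f zero + s) (sum-< (f ∘ suc) i)

sum-> : (f : Fin n → ℤ) (i : Fin n) →
        sum (λ j → does (i Fin.<? j) ⋆ f j) + (prefixSum f i + f i) ≡ sum f
sum-> f zero = swap₃ (sum (f ∘ suc)) (f zero)
  where
  swap₃ : ∀ x y → (0ℤ + x) + (0ℤ + y) ≡ y + x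
  swap₃ = solve-∀
sum-> f (suc i) = trans (rearrange (sum (λ j → does (i Fin.<? j) ⋆ f (suc j))) (f zero) (prefixSum (f ∘ suc) i) (f (suc i)))
                        (cong (λ s → f zero + s) (sum-> (f ∘ suc) i))
  where
  rearrange : ∀ x y z u → (0ℤ + x) + ((y + z) + u) ≡ y + (x + (z + u))
  rearrange = solve-∀

≡-neg⇒≡0 : ∀ x → x ≡ - x → x ≡ 0ℤ
-- For a nonzero integer the two sides have different constructors, so only zero remains.
≡-neg⇒≡0 (+ zero) _ = refl

∑ᵖ : (Point k l → ℤ) → ℤ
∑ᵖ g = sum (g ∘ inj₁) + sum (g ∘ inj₂)

∑ᵖ-cong : {f g : Point k l → ℤ} → f ≗ g → ∑ᵖ f ≡ ∑ᵖ g
∑ᵖ-cong f≗g = cong₂ _+_ (Sum.sum-cong-≗ (f≗g ∘ inj₁)) (Sum.sum-cong-≗ (f≗g ∘ inj₂))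

∑ᵖ-+ : (f g : Point k l → ℤ) → ∑ᵖ (λ x → f x + g x) ≡ ∑ᵖ f + ∑ᵖ g
∑ᵖ-+ f g = trans (cong₂ _+_ (Sum.∑-distrib-+ (f ∘ inj₁) (g ∘ inj₁)) (Sum.∑-distrib-+ (f ∘ inj₂) (g ∘ inj₂)))
                 (rearrange (sum (f ∘ inj₁)) (sum (g ∘ inj₁)) (sum (f ∘ inj₂)) (sum (g ∘ inj₂)))
  where
  rearrange : ∀ a b c d → (a + b) + (c + d) ≡ (a + c) + (b + d)
  rearrange = solve-∀

∑ᵖ-neg : (f : Point k l → ℤ) → ∑ᵖ (λ x → - f x) ≡ - ∑ᵖ f
∑ᵖ-neg f = trans (cong₂ _+_ (sum-neg (f ∘ inj₁)) (sum-neg (f ∘ inj₂)))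
                 (sym (ℤ.neg-distrib-+ (sum (f ∘ inj₁)) (sum (f ∘ inj₂))))

∑ᵖ-single : (f : Point k l → ℤ) (α : Point k l) → ∑ᵖ (λ x → does (x ≟ᵖ α) ⋆ f x) ≡ f α
∑ᵖ-single f (upper i) = trans
  (cong₂ _+_ (sum-single (f ∘ inj₁) i)
             (sum-zero (λ j → does (inj₂ j ≟ᵖ upper i) ⋆ f (inj₂ j)) λ _ → refl))
  (ℤ.+-identityʳ _)
∑ᵖ-single f (lower j) = trans
  (cong₂ _+_ (sum-zero (λ i → does (inj₁ i ≟ᵖ lower j) ⋆ f (inj₁ i)) λ _ → refl)
             (sum-single (f ∘ inj₂) j))
  (ℤ.+-identityˡ _)

sum-splitAt : ∀ k (g : Point k l → ℤ) → sum (g ∘ splitAt k) ≡ ∑ᵖ g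
sum-splitAt zero    g = sym (ℤ.+-identityˡ _)
sum-splitAt (suc k) g = trans (cong (λ s → g (inj₁ zero) + s) (sum-splitAt k (g ∘ map-⊎ suc id)))
                              (sym (ℤ.+-assoc (g (inj₁ zero)) _ _))

-- Conjugating `π` with the bijection between points and `Fin (k ℕ.+ l)` gives a permutation of the
-- index set, under which `sum` is invariant.
∑ᵖ-involution : (π : Point k l → Point k l) → (∀ x → π (π x) ≡ x) →
                (g : Point k l → ℤ) → ∑ᵖ (g ∘ π) ≡ ∑ᵖ g
∑ᵖ-involution {k} {l} π ππ g = begin
  ∑ᵖ (g ∘ π)                                  ≡⟨ sum-splitAt k (g ∘ π) ⟨
  sum (g ∘ π ∘ splitAt k)                     ≡⟨ Sum.sum-cong-≗ (λ i → cong g (Fin.splitAt-join k l (π (splitAt k i)))) ⟨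
  sum (g ∘ splitAt k ∘ π′)                    ≡⟨ Sum.sum-permute (g ∘ splitAt k) (permutation π′ π′ π′π′ π′π′) ⟨
  sum (g ∘ splitAt k)                         ≡⟨ sum-splitAt k g ⟩
  ∑ᵖ g                                        ∎
  where
  open ≡-Reasoning
  π′ : Fin (k ℕ.+ l) → Fin (k ℕ.+ l)
  π′ = join k l ∘ π ∘ splitAt k

  π′π′ : ∀ i → π′ (π′ i) ≡ i
  π′π′ i = trans (cong (join k l ∘ π) (Fin.splitAt-join k l (π (splitAt k i))))
          (trans (cong (join k l) (ππ (splitAt k i))) (Fin.join-splitAt k l i))

-- Reindexing along `π` turns the sum into its own negative. All cancellations between partners
-- below come from here.
∑ᵖ-skew : (π : Point k l → Point k l) → (∀ x → π (π x) ≡ x) →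
          (g : Point k l → ℤ) → (∀ x → g (π x) ≡ - g x) → ∑ᵖ g ≡ 0ℤ
∑ᵖ-skew π ππ g skew = ≡-neg⇒≡0 (∑ᵖ g)
  (trans (sym (∑ᵖ-involution π ππ g)) (trans (∑ᵖ-cong skew) (∑ᵖ-neg g)))

-- The cyclic order

infix 4 _≺_
-- The order of positions, read off the rows directly: comparisons reduce by cases on the rows, and
-- the arithmetic of `opposite` is confined to the translation.
_≺_ : Rel (Point k l) 0ℓ
lower j ≺ lower j′ = j Fin.< j′
lower _ ≺ upper _  = ⊤
upper _ ≺ lower _  = ⊥
upper i ≺ upper i′ = i′ Fin.< i

_≺?_ : Decidable (_≺_ {k} {l})
lower j ≺? lower j′ = j Fin.<? j′
lower _ ≺? upper _  = yes tt
upper _ ≺? lower _  = no λ ()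
upper i ≺? upper i′ = i′ Fin.<? i

≺-trans : {α β γ : Point k l} → α ≺ β → β ≺ γ → α ≺ γ
≺-trans {α = lower _} {lower _} {lower _} p q = Fin.<-trans p q
≺-trans {α = lower _} {lower _} {upper _} p q = tt
≺-trans {α = lower _} {upper _} {upper _} p q = tt
≺-trans {α = upper _} {upper _} {upper _} p q = Fin.<-trans q p

≺-irrefl : {α : Point k l} → ¬ α ≺ α
≺-irrefl {α = lower j} = ℕ.<-irrefl refl
≺-irrefl {α = upper i} = ℕ.<-irrefl refl

≺-asym : {α β : Point k l} → α ≺ β → ¬ β ≺ α
≺-asym p q = ≺-irrefl (≺-trans p q)

≺-cmp : Trichotomous {A = Point k l} _≡_ _≺_
≺-cmp (lower j) (lower j′) with Fin.<-cmp j j′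
... | tri< a b c = tri< a (λ { refl → b refl }) c
... | tri≈ a refl c = tri≈ a refl c
... | tri> a b c = tri> a (λ { refl → b refl }) c
≺-cmp (lower _) (upper _) = tri< tt (λ ()) λ ()
≺-cmp (upper _) (lower _) = tri> (λ ()) (λ ()) tt
≺-cmp (upper i) (upper i′) with Fin.<-cmp i i′
... | tri< a b c = tri> c (λ { refl → b refl }) a
... | tri≈ a refl c = tri≈ a refl c
... | tri> a b c = tri< c (λ { refl → b refl }) a

opposite-anti : {i j : Fin n} → i Fin.< j → opposite j Fin.< opposite i
opposite-anti {i = i} {j} i<j = subst₂ ℕ._<_ (sym (Fin.opposite-prop j)) (sym (Fin.opposite-prop i))
  (ℕ.∸-monoʳ-< (ℕ.s<s i<j) (Fin.toℕ<n j))

≺⇒position< : (α β : Point k l) → α ≺ β → position α ℕ.< position β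
≺⇒position< (lower j) (lower j′) p = p
≺⇒position< (lower j) (upper i)  p = ℕ.≤-trans (Fin.toℕ<n j) (ℕ.m≤m+n _ _)
≺⇒position< {l = l} (upper i) (upper i′) p = ℕ.+-monoʳ-< l (opposite-anti p)

position<⇒≺ : (α β : Point k l) → position α ℕ.< position β → α ≺ β
position<⇒≺ α β p with ≺-cmp α β
... | tri< a _ _ = a
... | tri≈ _ refl _ = contradiction p (ℕ.<-irrefl refl)
... | tri> _ _ c = contradiction p (ℕ.<-asym (≺⇒position< β α c))

Cyc : Point k l → Point k l → Point k l → Set
Cyc α γ β = (α ≺ γ × γ ≺ β) ⊎ (γ ≺ β × β ≺ α) ⊎ (β ≺ α × α ≺ γ)

cyc? : (α γ β : Point k l) → Dec (Cyc α γ β)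
cyc? α γ β = (α ≺? γ ×-dec γ ≺? β) ⊎-dec (γ ≺? β ×-dec β ≺? α) ⊎-dec (β ≺? α ×-dec α ≺? γ)

Cyc⇔arc : (α γ β : Point k l) → Cyc α γ β ⇔ ] α , β [ γ
Cyc⇔arc α γ β = mk⇔
  (map-⊎ (both α γ γ β) (map-⊎ (both γ β β α) (both β α α γ)))
  (map-⊎ (both⁻ α γ γ β) (map-⊎ (both⁻ γ β β α) (both⁻ β α α γ)))
  where
  both : ∀ a b c d → a ≺ b × c ≺ d → position a ℕ.< position b × position c ℕ.< position d
  both a b c d (p , q) = ≺⇒position< a b p , ≺⇒position< c d q
  both⁻ : ∀ a b c d → position a ℕ.< position b × position c ℕ.< position d → a ≺ b × c ≺ d
  both⁻ a b c d (p , q) = position<⇒≺ a b p , position<⇒≺ c d q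

Cyc-asym : {α β γ : Point k l} → Cyc α γ β → ¬ Cyc β γ α
Cyc-asym (inj₁ (p , q)) (inj₁ (r , s)) = ≺-asym q r
Cyc-asym (inj₁ (p , q)) (inj₂ (inj₁ (r , s))) = ≺-asym p r
Cyc-asym (inj₁ (p , q)) (inj₂ (inj₂ (r , s))) = ≺-asym q s
Cyc-asym (inj₂ (inj₁ (p , q))) (inj₁ (r , s)) = ≺-asym p r
Cyc-asym (inj₂ (inj₁ (p , q))) (inj₂ (inj₁ (r , s))) = ≺-asym q s
Cyc-asym (inj₂ (inj₁ (p , q))) (inj₂ (inj₂ (r , s))) = ≺-asym q r
Cyc-asym (inj₂ (inj₂ (p , q))) (inj₁ (r , s)) = ≺-asym q s
Cyc-asym (inj₂ (inj₂ (p , q))) (inj₂ (inj₁ (r , s))) = ≺-asym q r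
Cyc-asym (inj₂ (inj₂ (p , q))) (inj₂ (inj₂ (r , s))) = ≺-asym p r

Cyc-total : {α β γ : Point k l} → α ≢ β → γ ≢ α → γ ≢ β → Cyc α γ β ⊎ Cyc β γ α
Cyc-total {α = α} {β} {γ} α≢β γ≢α γ≢β with ≺-cmp α β | ≺-cmp γ α | ≺-cmp γ β
... | tri≈ _ e _ | _ | _ = contradiction e α≢β
... | _ | tri≈ _ e _ | _ = contradiction e γ≢α
... | _ | _ | tri≈ _ e _ = contradiction e γ≢β
... | tri< p _ _ | tri< q _ _ | _          = inj₂ (inj₂ (inj₁ (q , p)))
... | tri< p _ _ | tri> _ _ q | tri< r _ _ = inj₁ (inj₁ (q , r))
... | tri< p _ _ | tri> _ _ q | tri> _ _ r = inj₂ (inj₂ (inj₂ (p , r)))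
... | tri> _ _ p | _          | tri< r _ _ = inj₁ (inj₂ (inj₁ (r , p)))
... | tri> _ _ p | tri> _ _ q | tri> _ _ r = inj₁ (inj₂ (inj₂ (p , q)))
... | tri> _ _ p | tri< q _ _ | tri> _ _ r = inj₂ (inj₁ (r , q))

-- Sums over arcs

height : (Point k l → ℤ) → Point k l → ℤ
height w α = ∑ᵖ (λ γ → does (γ ≺? α) ⋆ w γ)

∑arc : (Point k l → ℤ) → Point k l → Point k l → ℤ
∑arc w α β = ∑ᵖ (λ γ → does (cyc? α γ β) ⋆ w γ)

-- If `α ≺ β`, the arc, `α` and the points before `α` together make up the points before `β`. If
-- `β ≺ α`, they make up all points and once more those before `β`, and the total weight of all
-- points is zero.
∑arc≡ : (w : Point k l → ℤ) → ∑ᵖ w ≡ 0ℤ → ∀ α β → α ≢ β →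
        ∑arc w α β + (height w α + w α) ≡ height w β
∑arc≡ {k} {l} w w≡0 α β α≢β = begin
  ∑arc w α β + (height w α + w α)
    ≡⟨ cong (λ x → ∑arc w α β + (height w α + x)) (∑ᵖ-single w α) ⟨
  ∑arc w α β + (height w α + ∑ᵖ (λ γ → does (γ ≟ᵖ α) ⋆ w γ))
    ≡⟨ cong (λ s → ∑arc w α β + s) (∑ᵖ-+ (λ γ → does (γ ≺? α) ⋆ w γ) (λ γ → does (γ ≟ᵖ α) ⋆ w γ)) ⟨
  ∑arc w α β + ∑ᵖ (λ γ → does (γ ≺? α) ⋆ w γ + does (γ ≟ᵖ α) ⋆ w γ)
    ≡⟨ ∑ᵖ-+ (λ γ → does (cyc? α γ β) ⋆ w γ) (λ γ → does (γ ≺? α) ⋆ w γ + does (γ ≟ᵖ α) ⋆ w γ) ⟨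
  ∑ᵖ (λ γ → does (cyc? α γ β) ⋆ w γ + (does (γ ≺? α) ⋆ w γ + does (γ ≟ᵖ α) ⋆ w γ))
    ≡⟨ rest ⟩
  height w β ∎
  where
  open ≡-Reasoning
  lhs : Point k l → ℤ
  lhs γ = does (cyc? α γ β) ⋆ w γ + (does (γ ≺? α) ⋆ w γ + does (γ ≟ᵖ α) ⋆ w γ)

  -- The case analysis only has to supply the four truth values; with these in place an identity
  -- between constant multiples of `x` remains.
  ident : ∀ {a a′ b b′ c c′ d d′} x → a ≡ a′ → b ≡ b′ → c ≡ c′ → d ≡ d′ →
          a′ ⋆ x + (b′ ⋆ x + c′ ⋆ x) ≡ d′ ⋆ x → a ⋆ x + (b ⋆ x + c ⋆ x) ≡ d ⋆ x
  ident _ refl refl refl refl e = e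

  001→1 : ∀ x → 0ℤ + (0ℤ + x) ≡ x
  001→1 x = trans (ℤ.+-identityˡ _) (ℤ.+-identityˡ x)
  010→1 : ∀ x → 0ℤ + (x + 0ℤ) ≡ x
  010→1 x = trans (ℤ.+-identityˡ _) (ℤ.+-identityʳ x)
  100→1 : ∀ x → x + (0ℤ + 0ℤ) ≡ x
  100→1 x = ℤ.+-identityʳ x

  rest : ∑ᵖ lhs ≡ height w β
  rest with ≺-cmp α β
  ... | tri≈ _ e _ = contradiction e α≢β
  ... | tri< α≺β _ _ = ∑ᵖ-cong pointwise
    where
    pointwise : ∀ γ → lhs γ ≡ does (γ ≺? β) ⋆ w γ
    pointwise γ with ≺-cmp γ α
    ... | tri< p q r = ident (w γ)
      (dec-false (cyc? α γ β) λ { (inj₁ (s , t)) → r s ; (inj₂ (inj₁ (s , t))) → ≺-asym α≺β t ; (inj₂ (inj₂ (s , t))) → r t })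
      (dec-true (γ ≺? α) p) (dec-false (γ ≟ᵖ α) q) (dec-true (γ ≺? β) (≺-trans p α≺β)) (010→1 (w γ))
    ... | tri≈ p refl r = ident (w γ)
      (dec-false (cyc? α γ β) λ { (inj₁ (s , t)) → r s ; (inj₂ (inj₁ (s , t))) → ≺-asym α≺β t ; (inj₂ (inj₂ (s , t))) → r t })
      (dec-false (γ ≺? α) p) (dec-true (γ ≟ᵖ α) refl) (dec-true (γ ≺? β) α≺β) (001→1 (w γ))
    -- Matching on `toSum` keeps `γ ≺? β` itself in the goal, where `ident` can still replace its
    -- truth value.
    ... | tri> p q r with toSum (γ ≺? β)
    ...   | inj₁ t = ident (w γ)
      (dec-true (cyc? α γ β) (inj₁ (r , t)))
      (dec-false (γ ≺? α) p) (dec-false (γ ≟ᵖ α) q) (dec-true (γ ≺? β) t) (100→1 (w γ))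
    ...   | inj₂ ¬t = ident (w γ)
      (dec-false (cyc? α γ β) λ { (inj₁ (s , t)) → ¬t t ; (inj₂ (inj₁ (s , t))) → ¬t s ; (inj₂ (inj₂ (s , t))) → ≺-asym α≺β s })
      (dec-false (γ ≺? α) p) (dec-false (γ ≟ᵖ α) q) (dec-false (γ ≺? β) ¬t) refl
  ... | tri> _ _ β≺α = begin
    ∑ᵖ lhs ≡⟨ ∑ᵖ-cong pointwise ⟩
    ∑ᵖ (λ γ → does (γ ≺? β) ⋆ w γ + w γ) ≡⟨ ∑ᵖ-+ (λ γ → does (γ ≺? β) ⋆ w γ) w ⟩
    height w β + ∑ᵖ w ≡⟨ cong (λ s → height w β + s) w≡0 ⟩
    height w β + 0ℤ ≡⟨ ℤ.+-identityʳ _ ⟩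
    height w β ∎
    where
    ident′ : ∀ {a a′ b b′ c c′ d d′} x → a ≡ a′ → b ≡ b′ → c ≡ c′ → d ≡ d′ →
             a′ ⋆ x + (b′ ⋆ x + c′ ⋆ x) ≡ d′ ⋆ x + x → a ⋆ x + (b ⋆ x + c ⋆ x) ≡ d ⋆ x + x
    ident′ _ refl refl refl refl e = e

    pointwise : ∀ γ → lhs γ ≡ does (γ ≺? β) ⋆ w γ + w γ
    pointwise γ with ≺-cmp γ α
    ... | tri> p q r = ident′ (w γ)
      (dec-true (cyc? α γ β) (inj₂ (inj₂ (β≺α , r))))
      (dec-false (γ ≺? α) p) (dec-false (γ ≟ᵖ α) q) (dec-false (γ ≺? β) (≺-asym (≺-trans β≺α r)))
      (trans (100→1 (w γ)) (sym (ℤ.+-identityˡ _)))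
    ... | tri≈ p refl r = ident′ (w γ)
      (dec-false (cyc? α γ β) λ { (inj₁ (s , t)) → r s ; (inj₂ (inj₁ (s , t))) → ≺-asym s t ; (inj₂ (inj₂ (s , t))) → r t })
      (dec-false (γ ≺? α) p) (dec-true (γ ≟ᵖ α) refl) (dec-false (γ ≺? β) (≺-asym β≺α)) (cong (λ s → 0ℤ + s) (ℤ.+-identityˡ (w γ)))
    ... | tri< p q r with toSum (γ ≺? β)
    ...   | inj₁ t = ident′ (w γ)
      (dec-true (cyc? α γ β) (inj₂ (inj₁ (t , β≺α))))
      (dec-true (γ ≺? α) p) (dec-false (γ ≟ᵖ α) q) (dec-true (γ ≺? β) t) (cong (λ s → w γ + s) (ℤ.+-identityʳ (w γ)))
    ...   | inj₂ ¬t = ident′ (w γ)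
      (dec-false (cyc? α γ β) λ { (inj₁ (s , t)) → r s ; (inj₂ (inj₁ (s , t))) → ¬t s ; (inj₂ (inj₂ (s , t))) → r t })
      (dec-true (γ ≺? α) p) (dec-false (γ ≟ᵖ α) q) (dec-false (γ ≺? β) ¬t) (cong (λ s → 0ℤ + s) (ℤ.+-identityʳ (w γ)))

-- The sign on the upper row imitates normalized colors: the two copies of a glued point get
-- opposite weights from the same row function.
rowWeight : (Fin k → ℤ) → (Fin l → ℤ) → Point k l → ℤ
rowWeight u v (upper i) = - u i
rowWeight u v (lower j) = v j

-- Unlike the weight, this carries no sign, so the two copies of a glued point get the same value.
rowPrefix : (Fin k → ℤ) → (Fin l → ℤ) → Point k l → ℤ
rowPrefix u v (upper i) = prefixSum u i
rowPrefix u v (lower j) = prefixSum v j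

∑-rowWeight : (u : Fin k → ℤ) (v : Fin l → ℤ) → ∑ᵖ (rowWeight u v) ≡ sum v - sum u
∑-rowWeight u v = trans (cong (_+ sum v) (sum-neg u)) (ℤ.+-comm (- sum u) (sum v))

height-lower : (u : Fin k → ℤ) (v : Fin l → ℤ) (j : Fin l) →
               height (rowWeight u v) (lower j) ≡ prefixSum v j
height-lower {k} u v j = trans (cong₂ _+_ (sum-zero {k} (λ _ → 0ℤ) λ _ → refl) (sum-< v j)) (ℤ.+-identityˡ _)

-- The traversal reaches `upper i` after the whole lower row and the upper points to the right of
-- `i`, which count negatively. With equal row sums, what is left is the prefix of `u` including the
-- step of `i` itself.
height-upper : (u : Fin k → ℤ) (v : Fin l → ℤ) → sum u ≡ sum v → (i : Fin k) →
               height (rowWeight u v) (upper i) ≡ prefixSum u i + u i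
height-upper u v eq i = begin
  sum (λ j → does (i Fin.<? j) ⋆ (- u j)) + sum v
    ≡⟨ cong₂ _+_ (trans (Sum.sum-cong-≗ λ j → ⋆-neg (does (i Fin.<? j)) (u j))
                        (sum-neg (λ j → does (i Fin.<? j) ⋆ u j)))
                 (sym eq) ⟩
  - s + sum u                 ≡⟨ cong (λ t → - s + t) (sum-> u i) ⟨
  - s + (s + (prefixSum u i + u i)) ≡⟨ cancel s (prefixSum u i + u i) ⟩
  prefixSum u i + u i         ∎
  where
  open ≡-Reasoning
  s : ℤ
  s = sum (λ j → does (i Fin.<? j) ⋆ u j)
  cancel : ∀ x y → - x + (x + y) ≡ y
  cancel = solve-∀

-- Levels

sgn : Color → ℤ
sgn ○ = 1ℤ
sgn ● = -1ℤ

sgn-flip : ∀ c → sgn (flip c) ≡ - sgn c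
sgn-flip ○ = refl
sgn-flip ● = refl

flip-flip : ∀ c → flip (flip c) ≡ c
flip-flip ○ = refl
flip-flip ● = refl

flip-≢ : ∀ c → flip c ≢ c
flip-≢ ○ ()
flip-≢ ● ()

≢⇒≡flip : ∀ c c′ → c ≢ c′ → c′ ≡ flip c
≢⇒≡flip ○ ○ ne = contradiction refl ne
≢⇒≡flip ○ ● _  = refl
≢⇒≡flip ● ○ _  = refl
≢⇒≡flip ● ● ne = contradiction refl ne

signs : Vec Color n → Fin n → ℤ
signs C i = sgn (lookup C i)

-- The level of a point is the lower end of its step, so that an up step and a
-- down step over the same interval have equal level.
floor : Color → ℤ
floor ○ = 0ℤ
floor ● = -1ℤ

level : Vec Color n → Fin n → ℤ
level C i = prefixSum (signs C) i + floor (lookup C i)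

module _ (U : Vec Color k) (L : Vec Color l) where

  normal : Point k l → Color
  normal (upper i) = flip (lookup U i)
  normal (lower j) = lookup L j

  pointLevel : Point k l → ℤ
  pointLevel (upper i) = level U i
  pointLevel (lower j) = level L j

  pointSign : Point k l → ℤ
  pointSign = rowWeight (signs U) (signs L)

  pointSign≡ : ∀ α → pointSign α ≡ sgn (normal α)
  pointSign≡ (upper i) = sym (sgn-flip (lookup U i))
  pointSign≡ (lower j) = refl

  -- An upper step is met at its right end and traversed backwards with the flipped color, which has
  -- the same lower end as the step read forwards.
  height-level : sum (signs U) ≡ sum (signs L) → ∀ α →
                 height pointSign α + floor (normal α) ≡ pointLevel α
  height-level eq (lower j) = cong (λ s → s + floor (lookup L j)) (height-lower (signs U) (signs L) j)
  height-level eq (upper i) = trans (cong (λ s → s + floor (flip (lookup U i))) (height-upper (signs U) (signs L) eq i))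
                                    (turn (prefixSum (signs U) i) (lookup U i))
    where
    turn : ∀ x c → (x + sgn c) + floor (flip c) ≡ x + floor c
    turn x ○ = ℤ.+-assoc x 1ℤ -1ℤ
    turn x ● = ℤ.+-assoc x -1ℤ 0ℤ

-- Color sums and distances as differences of levels

module _ {U : Vec Color k} {L : Vec Color l} (p : Partition U L) where

  normColor≡ : ∀ α → normColor p α ≡ normal U L α
  normColor≡ (upper i) = refl
  normColor≡ (lower j) = refl

  module _ {S : Pred (Point k l) ℓ} (S? : Decidable₁ S) where

    private
      with-color : Color → List (Point k l) → ℕ
      with-color c = length ∘ filter (λ α → S? α ×-dec (normColor p α ≟ᶜ c))

      signed : Point k l → ℤ
      signed α = does (S? α) ⋆ pointSign U L α

      total : List (Point k l) → ℤ
      total = List.foldr (λ α s → signed α + s) 0ℤ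

      total-++ : ∀ xs ys → total (xs List.++ ys) ≡ total xs + total ys
      total-++ []       ys = sym (ℤ.+-identityˡ _)
      total-++ (x ∷ xs) ys = trans (cong (λ s → signed x + s) (total-++ xs ys)) (sym (ℤ.+-assoc (signed x) _ _))

      total-tabulate : (f : Fin n → Point k l) → total (tabulate f) ≡ sum (signed ∘ f)
      total-tabulate {zero}  f = refl
      total-tabulate {suc n} f = cong (λ s → signed (f zero) + s) (total-tabulate (f ∘ suc))

      suc-left : ∀ x y → 1ℤ + (x - y) ≡ (1ℤ + x) - y
      suc-left = solve-∀

      suc-right : ∀ x y → -1ℤ + (x - y) ≡ x - (1ℤ + y)
      suc-right = solve-∀

      total≡ : ∀ xs → total xs ≡ + with-color ○ xs - + with-color ● xs
      total≡ [] = refl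
      -- Once the sign is expressed by `normColor`, one case split evaluates both filters and the
      -- indicator at `x`.
      total≡ (x ∷ xs) rewrite pointSign≡ U L x | sym (normColor≡ x) with S? x | normColor p x
      ... | no _  | _ = trans (ℤ.+-identityˡ _) (total≡ xs)
      ... | yes _ | ○ = trans (cong (λ s → 1ℤ + s) (total≡ xs)) (suc-left (+ with-color ○ xs) (+ with-color ● xs))
      ... | yes _ | ● = trans (cong (λ s → -1ℤ + s) (total≡ xs)) (suc-right (+ with-color ○ xs) (+ with-color ● xs))

    σ≡∑ : σ p S? ≡ ∑ᵖ (λ α → does (S? α) ⋆ pointSign U L α)
    σ≡∑ = begin
      σ p S?                             ≡⟨ ℤ.m-n≡m⊖n (with-color ○ (points k l)) (with-color ● (points k l)) ⟨
      + with-color ○ (points k l) - + with-color ● (points k l) ≡⟨ total≡ (points k l) ⟨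
      total (points k l)                 ≡⟨ total-++ (List.map inj₁ (List.allFin k)) (List.map inj₂ (List.allFin l)) ⟩
      total (List.map inj₁ (List.allFin k)) + total (List.map inj₂ (List.allFin l))
        ≡⟨ cong₂ _+_ (row inj₁) (row inj₂) ⟩
      ∑ᵖ signed                          ∎
      where
      open ≡-Reasoning
      row : (f : Fin n → Point k l) → total (List.map f (List.allFin n)) ≡ sum (signed ∘ f)
      row f = trans (cong total (map-tabulate id f)) (total-tabulate f)

  σ-open : ∀ α β → σ p (open? α β) ≡ ∑arc (pointSign U L) α β
  σ-open α β = trans (σ≡∑ (open? α β)) (∑ᵖ-cong λ γ →
    cong (_⋆ pointSign U L γ) (sym (does-⇔ (Cyc⇔arc α γ β) (cyc? α γ β) (open? α β γ))))

  σ-halfOpen : ∀ {α β} → α ≢ β →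
               σ p (halfOpen? α β) ≡ ∑arc (pointSign U L) α β + pointSign U L β
  σ-halfOpen {α} {β} α≢β = begin
    σ p (halfOpen? α β) ≡⟨ σ≡∑ (halfOpen? α β) ⟩
    ∑ᵖ (λ γ → does (halfOpen? α β γ) ⋆ w γ) ≡⟨ ∑ᵖ-cong pointwise ⟩
    ∑ᵖ (λ γ → does (cyc? α γ β) ⋆ w γ + does (γ ≟ᵖ β) ⋆ w γ) ≡⟨ ∑ᵖ-+ (λ γ → does (cyc? α γ β) ⋆ w γ) (λ γ → does (γ ≟ᵖ β) ⋆ w γ) ⟩
    ∑arc w α β + ∑ᵖ (λ γ → does (γ ≟ᵖ β) ⋆ w γ) ≡⟨ cong (λ s → ∑arc w α β + s) (∑ᵖ-single w β) ⟩
    ∑arc w α β + w β ∎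
    where
    open ≡-Reasoning
    w : Point k l → ℤ
    w = pointSign U L

    combine : ∀ {a a′ b b′ c c′} x → a ≡ a′ → b ≡ b′ → c ≡ c′ →
              a′ ⋆ x ≡ b′ ⋆ x + c′ ⋆ x → a ⋆ x ≡ b ⋆ x + c ⋆ x
    combine _ refl refl refl e = e

    pointwise : ∀ γ → does (halfOpen? α β γ) ⋆ w γ ≡ does (cyc? α γ β) ⋆ w γ + does (γ ≟ᵖ β) ⋆ w γ
    pointwise γ with toSum (γ ≟ᵖ β)
    ... | inj₁ refl = combine (w γ) (dec-true (halfOpen? α β γ) (α≢β , inj₂ refl))
      (dec-false (cyc? α γ β) λ { (inj₁ (_ , r)) → ≺-irrefl r ; (inj₂ (inj₁ (r , _))) → ≺-irrefl r ; (inj₂ (inj₂ (r , s))) → ≺-asym r s })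
      (dec-true (γ ≟ᵖ β) refl) (sym (ℤ.+-identityˡ _))
    ... | inj₂ γ≢β = combine {b = does (cyc? α γ β)} (w γ)
      (does-⇔ (mk⇔ (λ { (_ , inj₁ r) → Equivalence.from (Cyc⇔arc α γ β) r ; (_ , inj₂ e) → contradiction e γ≢β })
                    λ r → α≢β , inj₁ (Equivalence.to (Cyc⇔arc α γ β) r))
               (halfOpen? α β γ) (cyc? α γ β))
      refl (dec-false (γ ≟ᵖ β) γ≢β) (sym (ℤ.+-identityʳ _))

  -- The open arc climbs from the height after the step of `α` to the height before the step of `β`.
  -- For equal colors, the included step of `β` makes up for the omitted step of `α`; for opposite
  -- colors, the two floors differ by just that step.
  δ≡level : sum (signs U) ≡ sum (signs L) → ∀ {α β} → α ≢ β →
            δ p α β ≡ pointLevel U L β - pointLevel U L α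
  δ≡level eq {α} {β} α≢β =
    trans by-color (cong₂ _-_ (height-level U L eq β) (height-level U L eq α))
    where
    w : Point k l → ℤ
    w = pointSign U L
    hα hβ arc : ℤ
    hα  = height w α
    hβ  = height w β
    arc = ∑arc w α β

    arc≡ : arc ≡ hβ - (hα + w α)
    arc≡ = trans (shift arc (hα + w α)) (cong (λ s → s - (hα + w α))
      (∑arc≡ w (trans (∑-rowWeight (signs U) (signs L)) (ℤ.i≡j⇒i-j≡0 (sym eq))) α β α≢β))
      where
      shift : ∀ x y → x ≡ (x + y) - y
      shift = solve-∀

    same : ∀ c x y → (y - (x + sgn c)) + sgn c ≡ (y + floor c) - (x + floor c)
    same c = go (sgn c) (floor c)
      where
      go : ∀ s b x y → (y - (x + s)) + s ≡ (y + b) - (x + b)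
      go = solve-∀

    ○→● : ∀ x y → y - (x + 1ℤ) ≡ (y + -1ℤ) - (x + 0ℤ)
    ○→● = solve-∀
    ●→○ : ∀ x y → y - (x + -1ℤ) ≡ (y + 0ℤ) - (x + -1ℤ)
    ●→○ = solve-∀

    half≡ : σ p (halfOpen? α β) ≡ (hβ - (hα + sgn (normal U L α))) + sgn (normal U L β)
    half≡ = trans (σ-halfOpen α≢β) (cong₂ _+_ (trans arc≡ (cong (λ s → hβ - (hα + s)) (pointSign≡ U L α))) (pointSign≡ U L β))

    open≡ : σ p (open? α β) ≡ hβ - (hα + sgn (normal U L α))
    open≡ = trans (σ-open α β) (trans arc≡ (cong (λ s → hβ - (hα + s)) (pointSign≡ U L α)))

    by-color : δ p α β ≡ (hβ + floor (normal U L β)) - (hα + floor (normal U L α))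
    -- `half≡` and `open≡` take part in the `with` so that their colors are specialised together
    -- with those of the goal.
    by-color rewrite normColor≡ α | normColor≡ β with normal U L α | normal U L β | half≡ | open≡
    ... | ○ | ○ | h | _ = trans h (same ○ hα hβ)
    ... | ● | ● | h | _ = trans h (same ● hα hβ)
    ... | ○ | ● | _ | o = trans o (○→● hα hβ)
    ... | ● | ○ | _ | o = trans o (●→○ hα hβ)

  δ-opposed : ∀ {α β} → normColor p α ≢ normColor p β → δ p α β ≡ σ p (open? α β)
  δ-opposed {α} {β} ne with normColor p α ≟ᶜ normColor p β
  ... | yes e = contradiction e ne
  ... | no _  = refl

  cross⇒≢ : ∀ {α β} → Cross p α β → α ≢ β
  cross⇒≢ (α≁β , _) refl = α≁β (Partition.∼-refl p)

  -- A neutral pair partition, presented by the involution whose orbits are its blocks.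
  record Pairing : Set where
    field
      partner  : Point k l → Point k l
      isBlock  : ∀ α → PairBlock p α (partner α)
      opposed  : ∀ α → normal U L (partner α) ≡ flip (normal U L α)

    open Partition p using (∼-sym; ∼-refl)

    ∼-partner : ∀ α → p [ α ∼ partner α ]
    ∼-partner α = Equivalence.from (proj₂ (isBlock α) (partner α)) (inj₂ refl)

    ∼⇒ : ∀ {α β} → p [ α ∼ β ] → β ≡ α ⊎ β ≡ partner α
    ∼⇒ {α} {β} = Equivalence.to (proj₂ (isBlock α) β)

    partner-involutive : ∀ α → partner (partner α) ≡ α
    partner-involutive α with ∼⇒ (∼-sym (∼-partner α))
    ... | inj₁ e = contradiction e (proj₁ (isBlock α))
    ... | inj₂ e = sym e

    PairBlock⇒ : ∀ {α β} → PairBlock p α β → β ≡ partner α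
    PairBlock⇒ {α} {β} (α≢β , block) with ∼⇒ (Equivalence.from (block β) (inj₂ refl))
    ... | inj₁ e = contradiction (sym e) α≢β
    ... | inj₂ e = e

    pointSign-skew : ∀ α → pointSign U L (partner α) ≡ - pointSign U L α
    pointSign-skew α = begin
      pointSign U L (partner α)     ≡⟨ pointSign≡ U L (partner α) ⟩
      sgn (normal U L (partner α))  ≡⟨ cong sgn (opposed α) ⟩
      sgn (flip (normal U L α))     ≡⟨ sgn-flip (normal U L α) ⟩
      - sgn (normal U L α)          ≡⟨ cong -_ (pointSign≡ U L α) ⟨
      - pointSign U L α             ∎
      where open ≡-Reasoning

    -- Partners cancel, so the total weight vanishes; because of the sign on the upper row it is the
    -- difference of the row sums.
    skew⇒sum≡ : (u : Fin k → ℤ) (v : Fin l → ℤ) →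
                (∀ α → rowWeight u v (partner α) ≡ - rowWeight u v α) → sum u ≡ sum v
    skew⇒sum≡ u v skew = sym (ℤ.i-j≡0⇒i≡j (sum v) (sum u)
      (trans (sym (∑-rowWeight u v)) (∑ᵖ-skew partner partner-involutive (rowWeight u v) skew)))

    sum-signs≡ : sum (signs U) ≡ sum (signs L)
    sum-signs≡ = skew⇒sum≡ (signs U) (signs L) pointSign-skew

  -- Membership in `𝓘 D` restated without arcs. All closure properties are proved in this form.
  record Levelled (D : Pred ℕ ℓ) : Set ℓ where
    field
      pairing  : Pairing
      ∼⇒level≡ : ∀ {α β} → p [ α ∼ β ] → pointLevel U L α ≡ pointLevel U L β
      avoids   : ∀ {α β} → Cross p α β → ¬ D ∣ pointLevel U L β - pointLevel U L α ∣

  Levelled⇒𝓘 : {D : Pred ℕ ℓ} → Levelled D → 𝓘 D p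
  Levelled⇒𝓘 {D = D} lv = record
    { in-𝓢₀ = record
      { in-𝓟₂,nb = record
        { isPair  = λ α → partner α , isBlock α
        ; neutral = neutral
        }
      ; balanced = balanced
      }
    ; avoids-D = λ {b} {b′} cross → subst (λ z → ¬ D ∣ z ∣)
        (sym (δ≡level sum-signs≡ {b} {b′} (cross⇒≢ cross))) (avoids cross)
    }
    where
    open Levelled lv
    open Pairing pairing

    neutral : ∀ {α β} → PairBlock p α β → normColor p α ≢ normColor p β
    neutral {α} {β} block e with refl ← PairBlock⇒ block =
      flip-≢ (normal U L α) (trans (sym (opposed α)) (trans (sym (normColor≡ β)) (trans (sym e) (normColor≡ α))))

    balanced : ∀ {α β} → PairBlock p α β → σ p (open? α β) ≡ 0ℤ
    -- For opposite colors `δ` is the sum over the open arc, and it vanishes because the levels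
    -- agree.
    balanced {α} {β} block = trans (sym (δ-opposed (neutral block))) (trans (δ≡level sum-signs≡ (proj₁ block))
      (ℤ.i≡j⇒i-j≡0 (sym (∼⇒level≡ (Equivalence.from (proj₂ block β) (inj₂ refl))))))

  𝓘⇒Levelled : {D : Pred ℕ ℓ} → 𝓘 D p → Levelled D
  𝓘⇒Levelled {D = D} p∈𝓘 = record
    { pairing  = pairing
    ; ∼⇒level≡ = ∼⇒level≡
    ; avoids   = λ {α} {β} cross → subst (λ z → ¬ D ∣ z ∣)
        (δ≡level sum-signs≡ {α} {β} (cross⇒≢ cross)) (avoids-D cross)
    }
    where
    open 𝓘 p∈𝓘
    open 𝓢₀ in-𝓢₀
    open 𝓟₂,nb in-𝓟₂,nb

    pairing : Pairing
    pairing = record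
      { partner = proj₁ ∘ isPair
      ; isBlock = proj₂ ∘ isPair
      ; opposed = λ α → ≢⇒≡flip _ _ λ e → neutral (proj₂ (isPair α))
          (trans (normColor≡ α) (trans e (sym (normColor≡ (proj₁ (isPair α))))))
      }

    open Pairing pairing

    ∼⇒level≡ : ∀ {α β} → p [ α ∼ β ] → pointLevel U L α ≡ pointLevel U L β
    ∼⇒level≡ {α} {β} α∼β with ∼⇒ α∼β
    ... | inj₁ refl = refl
    ... | inj₂ refl = sym (ℤ.i-j≡0⇒i≡j _ _ (trans (sym (δ≡level sum-signs≡ (proj₁ (isBlock α))))
                                            (trans (δ-opposed (neutral (isBlock α))) (balanced (isBlock α)))))

-- Embeddings and involution

mkPairing : {U : Vec Color k} {L : Vec Color l} (p : Partition U L) →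
            (∀ α → ∃ λ β → PairBlock p α β × normal U L β ≡ flip (normal U L α)) → Pairing p
mkPairing p pair = record
  { partner = proj₁ ∘ pair
  ; isBlock = proj₁ ∘ proj₂ ∘ pair
  ; opposed = proj₂ ∘ proj₂ ∘ pair
  }

-- Here `f` identifies `p` with a union of blocks of `q`. This covers equality of partitions, the
-- exchange of rows and both factors of a tensor product.
module Embedding {U : Vec Color k} {L : Vec Color l} {U′ : Vec Color k′} {L′ : Vec Color l′}
  (p : Partition U L) (q : Partition U′ L′) (f : Point k l → Point k′ l′)
  (injective : ∀ {x y} → f x ≡ f y → x ≡ y)
  (related : ∀ x y → q [ f x ∼ f y ] ⇔ p [ x ∼ y ])
  (closed : ∀ x γ → q [ f x ∼ γ ] → ∃ λ y → f y ≡ γ)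
  where

  PairBlock-map : ∀ {x y} → PairBlock p x y → PairBlock q (f x) (f y)
  PairBlock-map {x} {y} (x≢y , block) = x≢y ∘ injective , λ γ → mk⇔ (to γ) (from γ)
    where
    to : ∀ γ → q [ f x ∼ γ ] → γ ≡ f x ⊎ γ ≡ f y
    to γ r with z , refl ← closed x γ r =
      map-⊎ (cong f) (cong f) (Equivalence.to (block z) (Equivalence.to (related x z) r))
    from : ∀ γ → γ ≡ f x ⊎ γ ≡ f y → q [ f x ∼ γ ]
    from _ (inj₁ refl) = Partition.∼-refl q
    from _ (inj₂ refl) = Equivalence.from (related x y) (Equivalence.from (block y) (inj₂ refl))

  -- By `closed` all four witnesses come from `p`. The cyclic order is a separate hypothesis because
  -- the exchange of rows reverses it.
  Cross-reflect : (∀ {x y z} → Cyc (f x) (f y) (f z) → Cyc x y z) →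
                  ∀ {x y} → Cross q (f x) (f y) → Cross p x y
  Cross-reflect cyc {x} {y} (x≁y , α , β , γ , δ , xα , xβ , yγ , yδ , αγβ , βδα)
    with α′ , refl ← closed x α xα | β′ , refl ← closed x β xβ
       | γ′ , refl ← closed y γ yγ | δ′ , refl ← closed y δ yδ =
    x≁y ∘ Equivalence.from (related x y) , α′ , β′ , γ′ , δ′ ,
    Equivalence.to (related x α′) xα , Equivalence.to (related x β′) xβ ,
    Equivalence.to (related y γ′) yγ , Equivalence.to (related y δ′) yδ ,
    arc αγβ , arc βδα
    where
    arc : ∀ {α β γ} → ] f α , f β [ (f γ) → ] α , β [ γ
    arc {α} {β} {γ} = Equivalence.to (Cyc⇔arc α γ β) ∘ cyc ∘ Equivalence.from (Cyc⇔arc (f α) (f γ) (f β))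

module _ (D : Pred ℕ ℓ) where

  Levelled-≈ : {U : Vec Color k} {L : Vec Color l} {p q : Partition U L} →
               p ≈ q → Levelled p D → Levelled q D
  Levelled-≈ {p = p} {q} p≈q lv = record
    { pairing  = mkPairing q λ α → partner α , PairBlock-map (isBlock α) , opposed α
    ; ∼⇒level≡ = λ {α} {β} → ∼⇒level≡ ∘ Equivalence.from (p≈q α β)
    ; avoids   = avoids ∘ Cross-reflect id
    }
    where
    open Levelled lv
    open Pairing pairing
    open Embedding p q id id (λ x y → mk⇔ (Equivalence.from (p≈q x y)) (Equivalence.to (p≈q x y))) (λ x γ _ → γ , refl)

  module Involution {U : Vec Color k} {L : Vec Color l} {p : Partition U L} (lv : Levelled p D) where
    open Levelled lv
    open Pairing pairing

    swap-swap : (α : Point l k) → swap {A = Fin k} {B = Fin l} (swap α) ≡ α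
    swap-swap (upper i) = refl
    swap-swap (lower j) = refl

    swap-injective : {x y : Point k l} → swap x ≡ swap y → x ≡ y
    swap-injective {upper _} {upper _} refl = refl
    swap-injective {lower _} {lower _} refl = refl

    related : ∀ x y → (p *) [ swap x ∼ swap y ] ⇔ p [ x ∼ y ]
    related (upper _) (upper _) = mk⇔ id id
    related (upper _) (lower _) = mk⇔ id id
    related (lower _) (upper _) = mk⇔ id id
    related (lower _) (lower _) = mk⇔ id id

    open Embedding p (p *) swap swap-injective related (λ x γ _ → swap γ , swap-swap γ)

    normal-swap : ∀ α → normal L U (swap α) ≡ flip (normal U L α)
    normal-swap (upper i) = sym (flip-flip (lookup U i))
    normal-swap (lower j) = refl

    level-swap : ∀ α → pointLevel U L (swap α) ≡ pointLevel L U α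
    level-swap (upper i) = refl
    level-swap (lower j) = refl

    ≺-swap : (x y : Point l k) → x ≺ y → swap y ≺ swap x
    ≺-swap (upper _) (upper _) r = r
    ≺-swap (lower _) (upper _) r = tt
    ≺-swap (lower _) (lower _) r = r

    arc-swap : (α β γ : Point l k) → ] α , β [ γ → ] swap β , swap α [ (swap γ)
    arc-swap α β γ r = Equivalence.to (Cyc⇔arc (swap β) (swap γ) (swap α))
      (rev (Equivalence.from (Cyc⇔arc α γ β) r))
      where
      rev : Cyc α γ β → Cyc (swap β) (swap γ) (swap α)
      rev (inj₁ (r , s))        = inj₁ (≺-swap γ β s , ≺-swap α γ r)
      rev (inj₂ (inj₁ (r , s))) = inj₂ (inj₂ (≺-swap β α s , ≺-swap γ β r))
      rev (inj₂ (inj₂ (r , s))) = inj₂ (inj₁ (≺-swap α γ s , ≺-swap β α r))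

    -- Exchanging the rows reverses the cyclic order, so the two witnesses in the first block trade
    -- places.
    Cross-swap : ∀ {x y} → Cross (p *) x y → Cross p (swap x) (swap y)
    Cross-swap (x≁y , α , β , γ , δ , xα , xβ , yγ , yδ , αγβ , βδα) =
      x≁y , swap β , swap α , swap γ , swap δ , xβ , xα , yγ , yδ , arc-swap α β γ αγβ , arc-swap β α δ βδα

    involution : Levelled (p *) D
    involution = record
      { pairing  = mkPairing (p *) λ α → swap (partner (swap α)) ,
          subst (λ z → PairBlock (p *) z (swap (partner (swap α)))) (swap-swap α) (PairBlock-map (isBlock (swap α))) ,
          (begin
            normal L U (swap (partner (swap α))) ≡⟨ normal-swap (partner (swap α)) ⟩
            flip (normal U L (partner (swap α))) ≡⟨ cong flip (opposed (swap α)) ⟩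
            flip (flip (normal U L (swap α)))    ≡⟨ cong flip (normal-swap (swap α)) ⟨
            flip (normal L U (swap (swap α)))    ≡⟨ cong (flip ∘ normal L U) (swap-swap α) ⟩
            flip (normal L U α)                  ∎)
      ; ∼⇒level≡ = λ {α} {β} r → trans (sym (level-swap α)) (trans (∼⇒level≡ r) (level-swap β))
      ; avoids   = λ {α} {β} cross → subst₂ (λ x y → ¬ D ∣ y - x ∣) (level-swap α) (level-swap β) (avoids (Cross-swap cross))
      }
      where open ≡-Reasoning

  -- A crossing needs two different blocks, and there is only one. All three generators have this
  -- form.
  pair-levelled : {U : Vec Color k} {L : Vec Color l} (a b : Point k l) → a ≢ b →
                  (∀ x → x ≡ a ⊎ x ≡ b) → normal U L b ≡ flip (normal U L a) →
                  pointLevel U L a ≡ pointLevel U L b → Levelled (oneBlock U L) D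
  pair-levelled {U = U} {L} a b a≢b all opp lev = record
    { pairing = mkPairing (oneBlock U L) λ α → [ (λ { refl → b , (a≢b , λ γ → mk⇔ (λ _ → all γ) _) , opp })
                                               , (λ { refl → a , (a≢b ∘ sym , λ γ → mk⇔ (λ _ → [ inj₂ , inj₁ ]′ (all γ)) _)
                                                      , trans (sym (flip-flip _)) (cong flip (sym opp)) }) ]′ (all α)
    ; ∼⇒level≡ = λ {α} {β} _ → trans (to-a α) (sym (to-a β))
    ; avoids  = λ cross → contradiction _ (proj₁ cross)
    }
    where
    to-a : ∀ α → pointLevel U L α ≡ pointLevel U L a
    to-a α with all α
    ... | inj₁ refl = refl
    ... | inj₂ refl = sym lev

  identity-levelled : ∀ c → Levelled (oneBlock (c ∷ []) (c ∷ [])) D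
  identity-levelled c = pair-levelled (upper zero) (lower zero) (λ ())
    (λ { (upper zero) → inj₁ refl ; (lower zero) → inj₂ refl }) (sym (flip-flip c)) refl

  ○●-levelled : Levelled (oneBlock [] (○ ∷ ● ∷ [])) D
  ○●-levelled = pair-levelled (lower zero) (lower (suc zero)) (λ ())
    (λ { (lower zero) → inj₁ refl ; (lower (suc zero)) → inj₂ refl }) refl refl

  ●○-levelled : Levelled (oneBlock [] (● ∷ ○ ∷ [])) D
  ●○-levelled = pair-levelled (lower zero) (lower (suc zero)) (λ ())
    (λ { (lower zero) → inj₁ refl ; (lower (suc zero)) → inj₂ refl }) refl refl

-- Tensor products

prefixSum-++ˡ : (C : Vec Color m) (C′ : Vec Color n) (i : Fin m) →
                prefixSum (signs (C ++ C′)) (i ↑ˡ n) ≡ prefixSum (signs C) i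
prefixSum-++ˡ (c ∷ C) C′ zero    = refl
prefixSum-++ˡ (c ∷ C) C′ (suc i) = cong (λ s → sgn c + s) (prefixSum-++ˡ C C′ i)

prefixSum-++ʳ : (C : Vec Color m) (C′ : Vec Color n) (i : Fin n) →
                prefixSum (signs (C ++ C′)) (m ↑ʳ i) ≡ sum (signs C) + prefixSum (signs C′) i
prefixSum-++ʳ []      C′ i = sym (ℤ.+-identityˡ _)
prefixSum-++ʳ (c ∷ C) C′ i = trans (cong (λ s → sgn c + s) (prefixSum-++ʳ C C′ i)) (sym (ℤ.+-assoc (sgn c) _ _))

level-++ˡ : (C : Vec Color m) (C′ : Vec Color n) (i : Fin m) → level (C ++ C′) (i ↑ˡ n) ≡ level C i
level-++ˡ C C′ i = cong₂ _+_ (prefixSum-++ˡ C C′ i) (cong floor (lookup-++ˡ C C′ i))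

level-++ʳ : (C : Vec Color m) (C′ : Vec Color n) (i : Fin n) →
            level (C ++ C′) (m ↑ʳ i) ≡ sum (signs C) + level C′ i
level-++ʳ C C′ i = trans (cong₂ _+_ (prefixSum-++ʳ C C′ i) (cong floor (lookup-++ʳ C C′ i)))
                         (ℤ.+-assoc (sum (signs C)) _ _)

left : Point k l → Point (k ℕ.+ k′) (l ℕ.+ l′)
left (upper i) = upper (i ↑ˡ _)
left (lower j) = lower (j ↑ˡ _)

right : Point k′ l′ → Point (k ℕ.+ k′) (l ℕ.+ l′)
right (upper i) = upper (_ ↑ʳ i)
right (lower j) = lower (_ ↑ʳ j)

splitPoint-left : (x : Point k l) → splitPoint {k′ = k′} {l′ = l′} k l (left x) ≡ inj₁ x
splitPoint-left {k} {l} {k′} (upper i) = cong (map-⊎ inj₁ inj₁) (Fin.splitAt-↑ˡ k i k′)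
splitPoint-left {k} {l} {l′ = l′} (lower j) = cong (map-⊎ inj₂ inj₂) (Fin.splitAt-↑ˡ l j l′)

splitPoint-right : (x : Point k′ l′) → splitPoint k l (right x) ≡ inj₂ x
splitPoint-right {k = k} (upper i) = cong (map-⊎ inj₁ inj₁) (Fin.splitAt-↑ʳ k _ i)
splitPoint-right {l = l} (lower j) = cong (map-⊎ inj₂ inj₂) (Fin.splitAt-↑ʳ l _ j)

-- A view of the points of a tensor product: matching on it replaces a point by its preimage in one
-- of the factors.
data Side {k l k′ l′} : Point (k ℕ.+ k′) (l ℕ.+ l′) → Set where
  isLeft  : (x : Point k l) → Side (left x)
  isRight : (x : Point k′ l′) → Side (right x)

side : ∀ k l {k′ l′} (α : Point (k ℕ.+ k′) (l ℕ.+ l′)) → Side {k} {l} {k′} {l′} α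
side k l (upper i) with splitAt k i in eq
... | inj₁ x with refl ← Fin.splitAt⁻¹-↑ˡ eq = isLeft (upper x)
... | inj₂ x with refl ← Fin.splitAt⁻¹-↑ʳ {k} eq = isRight (upper x)
side k l (lower j) with splitAt l j in eq
... | inj₁ x with refl ← Fin.splitAt⁻¹-↑ˡ eq = isLeft (lower x)
... | inj₂ x with refl ← Fin.splitAt⁻¹-↑ʳ {l} eq = isRight (lower x)

module Tensor {ℓ} (D : Pred ℕ ℓ) {U : Vec Color k} {L : Vec Color l} {U′ : Vec Color k′} {L′ : Vec Color l′}
              {p : Partition U L} {p′ : Partition U′ L′} (lv : Levelled p D) (lv′ : Levelled p′ D) where

  private
    module P  = Levelled lv
    module P′ = Levelled lv′
    module π  = Pairing P.pairing
    module π′ = Pairing P′.pairing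

    inl : Point k l → Point (k ℕ.+ k′) (l ℕ.+ l′)
    inl = left

    inr : Point k′ l′ → Point (k ℕ.+ k′) (l ℕ.+ l′)
    inr = right

    _≋_ : Rel (Point k l ⊎ Point k′ l′) 0ℓ
    _≋_ = Pointwise (Partition._∼_ p) (Partition._∼_ p′)

  left-injective : ∀ {x y} → inl x ≡ inl y → x ≡ y
  left-injective {x} {y} e = inj₁-injective (trans (sym (splitPoint-left x)) (trans (cong (splitPoint k l) e) (splitPoint-left y)))

  right-injective : ∀ {x y} → inr x ≡ inr y → x ≡ y
  right-injective {x} {y} e = inj₂-injective (trans (sym (splitPoint-right x)) (trans (cong (splitPoint k l) e) (splitPoint-right y)))

  left-related : ∀ x y → (p ⊗ p′) [ inl x ∼ inl y ] ⇔ p [ x ∼ y ]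
  left-related x y = mk⇔ (λ r → drop (subst₂ _≋_ (splitPoint-left x) (splitPoint-left y) r))
                         (λ r → subst₂ _≋_ (sym (splitPoint-left x)) (sym (splitPoint-left y)) (inj₁ r))
    where
    drop : inj₁ x ≋ inj₁ y → p [ x ∼ y ]
    drop (inj₁ r) = r

  right-related : ∀ x y → (p ⊗ p′) [ inr x ∼ inr y ] ⇔ p′ [ x ∼ y ]
  right-related x y = mk⇔ (λ r → drop (subst₂ _≋_ (splitPoint-right x) (splitPoint-right y) r))
                          (λ r → subst₂ _≋_ (sym (splitPoint-right x)) (sym (splitPoint-right y)) (inj₂ r))
    where
    drop : inj₂ x ≋ inj₂ y → p′ [ x ∼ y ]
    drop (inj₂ r) = r

  unrelated : ∀ x y → ¬ (p ⊗ p′) [ inl x ∼ inr y ]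
  unrelated x y r with () ← subst₂ _≋_ (splitPoint-left x) (splitPoint-right y) r

  left-closed : ∀ x γ → (p ⊗ p′) [ inl x ∼ γ ] → ∃ λ y → inl y ≡ γ
  left-closed x γ r with side k l γ
  ... | isLeft y  = y , refl
  ... | isRight y = contradiction r (unrelated x y)

  right-closed : ∀ x γ → (p ⊗ p′) [ inr x ∼ γ ] → ∃ λ y → inr y ≡ γ
  right-closed x γ r with side k l γ
  ... | isLeft y  = contradiction (Partition.∼-sym (p ⊗ p′) {inr x} {inl y} r) (unrelated y x)
  ... | isRight y = y , refl

  module Left  = Embedding p  (p ⊗ p′) inl left-injective  left-related  left-closed
  module Right = Embedding p′ (p ⊗ p′) inr right-injective right-related right-closed

  normal-left : ∀ x → normal (U ++ U′) (L ++ L′) (inl x) ≡ normal U L x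
  normal-left (upper i) = cong flip (lookup-++ˡ U U′ i)
  normal-left (lower j) = lookup-++ˡ L L′ j

  normal-right : ∀ x → normal (U ++ U′) (L ++ L′) (inr x) ≡ normal U′ L′ x
  normal-right (upper i) = cong flip (lookup-++ʳ U U′ i)
  normal-right (lower j) = lookup-++ʳ L L′ j

  level-left : ∀ x → pointLevel (U ++ U′) (L ++ L′) (inl x) ≡ pointLevel U L x
  level-left (upper i) = level-++ˡ U U′ i
  level-left (lower j) = level-++ˡ L L′ j

  -- Both rows of `p` have the same color sum, so both rows of `p′` are raised by the same amount
  -- and differences of levels survive.
  level-right : ∀ x → pointLevel (U ++ U′) (L ++ L′) (inr x) ≡ sum (signs U) + pointLevel U′ L′ x
  level-right (upper i) = level-++ʳ U U′ i
  level-right (lower j) = trans (level-++ʳ L L′ j) (cong (λ s → s + level L′ j) (sym π.sum-signs≡))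

  ≺-left : ∀ x y → inl x ≺ inl y → x ≺ y
  ≺-left (lower i) (lower j) r = subst₂ ℕ._<_ (Fin.toℕ-↑ˡ i l′) (Fin.toℕ-↑ˡ j l′) r
  ≺-left (lower i) (upper j) r = tt
  ≺-left (upper i) (upper j) r = subst₂ ℕ._<_ (Fin.toℕ-↑ˡ j k′) (Fin.toℕ-↑ˡ i k′) r

  ≺-right : ∀ x y → inr x ≺ inr y → x ≺ y
  ≺-right (lower i) (lower j) r = ℕ.+-cancelˡ-< l _ _ (subst₂ ℕ._<_ (Fin.toℕ-↑ʳ l i) (Fin.toℕ-↑ʳ l j) r)
  ≺-right (lower i) (upper j) r = tt
  ≺-right (upper i) (upper j) r = ℕ.+-cancelˡ-< k _ _ (subst₂ ℕ._<_ (Fin.toℕ-↑ʳ k j) (Fin.toℕ-↑ʳ k i) r)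

  Cyc-map : ∀ {m n m′ n′} (f : Point m n → Point m′ n′) → (∀ x y → f x ≺ f y → x ≺ y) →
            ∀ {x y z} → Cyc (f x) (f y) (f z) → Cyc x y z
  Cyc-map f reflects {x} {y} {z} = map-⊎ (both x y y z) (map-⊎ (both y z z x) (both z x x y))
    where
    both : ∀ a b c d → f a ≺ f b × f c ≺ f d → a ≺ b × c ≺ d
    both a b c d (r , s) = reflects a b r , reflects c d s

  -- The traversal of `p ⊗ p′` visits the lower row of `p`, then all of `p′`, then the upper row of
  -- `p`.
  lower-≺-right : ∀ j d → inl (lower j) ≺ inr d
  lower-≺-right j (upper _) = tt
  lower-≺-right j (lower i) = subst₂ ℕ._<_ (sym (Fin.toℕ-↑ˡ j l′)) (sym (Fin.toℕ-↑ʳ l i))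
    (ℕ.≤-trans (Fin.toℕ<n j) (ℕ.m≤m+n l (toℕ i)))

  right-≺-upper : ∀ i d → inr d ≺ inl (upper i)
  right-≺-upper i (lower _) = tt
  right-≺-upper i (upper j) = subst₂ ℕ._<_ (sym (Fin.toℕ-↑ˡ i k′)) (sym (Fin.toℕ-↑ʳ k j))
    (ℕ.≤-trans (Fin.toℕ<n i) (ℕ.m≤m+n k (toℕ j)))

  -- The points of p′ form an interval of the cyclic order of p ⊗ p′.
  left≺right-move : ∀ a c d → inl a ≺ inr c → inl a ≺ inr d
  left≺right-move (lower j) c d _ = lower-≺-right j d
  left≺right-move (upper i) c d r = contradiction r (≺-asym (right-≺-upper i c))

  right≺left-move : ∀ a c d → inr c ≺ inl a → inr d ≺ inl a
  right≺left-move (upper i) c d _ = right-≺-upper i d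
  right≺left-move (lower j) c d r = contradiction r (≺-asym (lower-≺-right j c))

  -- An arc whose ends lie outside an interval contains all of the interval or none of it.
  Cyc-move : ∀ a b c d → Cyc (inl a) (inr c) (inl b) → Cyc (inl a) (inr d) (inl b)
  Cyc-move a b c d (inj₁ (r , s))        = inj₁ (left≺right-move a c d r , right≺left-move b c d s)
  Cyc-move a b c d (inj₂ (inj₁ (r , s))) = inj₂ (inj₁ (right≺left-move b c d r , s))
  Cyc-move a b c d (inj₂ (inj₂ (r , s))) = inj₂ (inj₂ (r , left≺right-move a c d s))

  -- An arc that starts and ends in the interval but leaves it has to wrap around. The two
  -- complementary arcs of a block cannot both do so.
  Cyc⇒≻ : ∀ a b c → Cyc (inr a) (inl c) (inr b) → inr b ≺ inr a
  Cyc⇒≻ a b c (inj₁ (r , s))        = contradiction (left≺right-move c b a s) (≺-asym r)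
  Cyc⇒≻ a b c (inj₂ (inj₁ (r , s))) = s
  Cyc⇒≻ a b c (inj₂ (inj₂ (r , s))) = r

  uncrossed-left : ∀ x y → ¬ Cross (p ⊗ p′) (inl x) (inr y)
  uncrossed-left x y (_ , α , β , γ , δ , xα , xβ , yγ , yδ , αγβ , βδα)
    with a , refl ← left-closed x α xα | b , refl ← left-closed x β xβ
       | c , refl ← right-closed y γ yγ | d , refl ← right-closed y δ yδ =
    Cyc-asym (Cyc-move a b c d (Equivalence.from (Cyc⇔arc (inl a) (inr c) (inl b)) αγβ))
             (Equivalence.from (Cyc⇔arc (inl b) (inr d) (inl a)) βδα)

  uncrossed-right : ∀ x y → ¬ Cross (p ⊗ p′) (inr x) (inl y)
  uncrossed-right x y (_ , α , β , γ , δ , xα , xβ , yγ , yδ , αγβ , βδα)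
    with a , refl ← right-closed x α xα | b , refl ← right-closed x β xβ
       | c , refl ← left-closed y γ yγ | d , refl ← left-closed y δ yδ =
    ≺-asym (Cyc⇒≻ a b c (Equivalence.from (Cyc⇔arc (inr a) (inl c) (inr b)) αγβ))
           (Cyc⇒≻ b a d (Equivalence.from (Cyc⇔arc (inr b) (inl d) (inr a)) βδα))

  tensor : Levelled (p ⊗ p′) D
  tensor = record { pairing = mkPairing (p ⊗ p′) pair ; ∼⇒level≡ = λ {α} {β} → level≡ α β ; avoids = λ {α} {β} → avoids α β }
    where
    pair : ∀ α → ∃ λ β → PairBlock (p ⊗ p′) α β × normal (U ++ U′) (L ++ L′) β ≡ flip (normal (U ++ U′) (L ++ L′) α)
    pair α with side k l α
    ... | isLeft x  = inl (π.partner x) , Left.PairBlock-map (π.isBlock x) ,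
      trans (normal-left (π.partner x)) (trans (π.opposed x) (cong flip (sym (normal-left x))))
    ... | isRight x = inr (π′.partner x) , Right.PairBlock-map (π′.isBlock x) ,
      trans (normal-right (π′.partner x)) (trans (π′.opposed x) (cong flip (sym (normal-right x))))

    lev : Point (k ℕ.+ k′) (l ℕ.+ l′) → ℤ
    lev = pointLevel (U ++ U′) (L ++ L′)

    level≡ : ∀ α β → (p ⊗ p′) [ α ∼ β ] → lev α ≡ lev β
    level≡ α β r with side k l α
    ... | isLeft x with y , refl ← left-closed x β r =
      trans (level-left x) (trans (P.∼⇒level≡ (Equivalence.to (left-related x y) r)) (sym (level-left y)))
    ... | isRight x with y , refl ← right-closed x β r =
      trans (level-right x) (trans
        (cong (λ s → sum (signs U) + s) (P′.∼⇒level≡ (Equivalence.to (right-related x y) r)))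
        (sym (level-right y)))

    shift : ∀ s x y → (s + y) - (s + x) ≡ y - x
    shift = solve-∀

    avoids : ∀ α β → Cross (p ⊗ p′) α β → ¬ D ∣ lev β - lev α ∣
    avoids α β cross with side k l α | side k l β
    ... | isLeft x  | isLeft y  = subst (λ z → ¬ D ∣ z ∣) (sym (cong₂ _-_ (level-left y) (level-left x)))
      (P.avoids {x} {y} (Left.Cross-reflect (Cyc-map inl ≺-left) {x} {y} cross))
    ... | isLeft x  | isRight y = contradiction cross (uncrossed-left x y)
    ... | isRight x | isLeft y  = contradiction cross (uncrossed-right x y)
    ... | isRight x | isRight y = subst (λ z → ¬ D ∣ z ∣)
      (sym (trans (cong₂ _-_ (level-right y) (level-right x)) (shift (sum (signs U)) (pointLevel U′ L′ x) (pointLevel U′ L′ y))))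
      (P′.avoids {x} {y} (Right.Cross-reflect (Cyc-map inr ≺-right) {x} {y} cross))

-- Composition

-- The height of an upper point includes its own step, which is zero here.
height≡rowPrefix : (u : Fin k → ℤ) (v : Fin l → ℤ) → sum u ≡ sum v → ∀ α →
                   rowWeight u v α ≡ 0ℤ → height (rowWeight u v) α ≡ rowPrefix u v α
height≡rowPrefix u v eq (lower j) _   = height-lower u v j
height≡rowPrefix u v eq (upper i) w≡0 = begin
  height (rowWeight u v) (upper i) ≡⟨ height-upper u v eq i ⟩
  prefixSum u i + u i              ≡⟨ cong (λ s → prefixSum u i + s) (ℤ.neg-injective w≡0) ⟩
  prefixSum u i + 0ℤ               ≡⟨ ℤ.+-identityʳ _ ⟩
  prefixSum u i                    ∎
  where open ≡-Reasoning

∑arc+rowPrefix : (u : Fin k → ℤ) (v : Fin l → ℤ) → sum u ≡ sum v → ∀ α β → α ≢ β →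
                 rowWeight u v α ≡ 0ℤ → rowWeight u v β ≡ 0ℤ →
                 ∑arc (rowWeight u v) α β + rowPrefix u v α ≡ rowPrefix u v β
∑arc+rowPrefix u v eq α β α≢β wα≡0 wβ≡0 = begin
  ∑arc w α β + rowPrefix u v α
    ≡⟨ cong (λ s → ∑arc w α β + s) (trans (cong₂ _+_ (height≡rowPrefix u v eq α wα≡0) wα≡0) (ℤ.+-identityʳ _)) ⟨
  ∑arc w α β + (height w α + w α)      ≡⟨ ∑arc≡ w ∑w≡0 α β α≢β ⟩
  height w β                           ≡⟨ height≡rowPrefix u v eq β wβ≡0 ⟩
  rowPrefix u v β                      ∎
  where
  open ≡-Reasoning
  w : Point _ _ → ℤ
  w = rowWeight u v
  ∑w≡0 : ∑ᵖ w ≡ 0ℤ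
  ∑w≡0 = trans (∑-rowWeight u v) (ℤ.i≡j⇒i-j≡0 (sym eq))

module _ {U : Vec Color k} {L : Vec Color l} {p : Partition U L} (pairing : Pairing p) where
  open Partition p using (∼-refl)
  open Pairing pairing

  -- An uncrossed block {x, y} cuts no other block, so every block lies on one
  -- side of it and its skew weights cancel on either side.
  rowPrefix-constant : (u : Fin k → ℤ) (v : Fin l → ℤ) →
                       (∀ α → rowWeight u v (partner α) ≡ - rowWeight u v α) →
                       ∀ {x y} → p [ x ∼ y ] → rowWeight u v x ≡ 0ℤ →
                       (∀ z → rowWeight u v z ≢ 0ℤ → ¬ Cross p x z) →
                       rowPrefix u v y ≡ rowPrefix u v x
  rowPrefix-constant u v skew {x} {y} x∼y wx≡0 uncrossed with ∼⇒ x∼y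
  ... | inj₁ refl = refl
  ... | inj₂ refl = trans (sym (∑arc+rowPrefix u v (skew⇒sum≡ u v skew) x y (proj₁ (isBlock x)) wx≡0 wy≡0))
      (trans (cong (λ s → s + rowPrefix u v x) (∑ᵖ-skew partner partner-involutive _ arc-skew)) (ℤ.+-identityˡ _))
    where
    w : Point k l → ℤ
    w = rowWeight u v

    wy≡0 : w y ≡ 0ℤ
    wy≡0 = trans (skew x) (cong -_ wx≡0)

    ≢0-partner : ∀ {z} → w z ≢ 0ℤ → w (partner z) ≢ 0ℤ
    ≢0-partner {z} wz≢0 e = wz≢0 (ℤ.neg-injective (trans (sym (skew z)) e))

    inside : ∀ z → w z ≢ 0ℤ → Cyc x z y → Cyc x (partner z) y
    -- As `x` and `y` have weight zero, `partner z` is neither of them; were it on the other arc,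
    -- the two blocks would cross.
    inside z wz≢0 xzy with Cyc-total {α = x} {y} {partner z} (proj₁ (isBlock x))
                           (λ { e → ≢0-partner wz≢0 (trans (cong w e) wx≡0) })
                           (λ { e → ≢0-partner wz≢0 (trans (cong w e) wy≡0) })
    ... | inj₁ c = c
    ... | inj₂ c = contradiction
      ( x≁z , x , y , z , partner z , ∼-refl , ∼-partner x , ∼-refl , ∼-partner z
      , Equivalence.to (Cyc⇔arc x z y) xzy , Equivalence.to (Cyc⇔arc y (partner z) x) c)
      (uncrossed z wz≢0)
      where
      x≁z : ¬ p [ x ∼ z ]
      x≁z r with ∼⇒ r
      ... | inj₁ e = wz≢0 (trans (cong w e) wx≡0)
      ... | inj₂ e = wz≢0 (trans (cong w e) wy≡0)

    arc-skew : ∀ z → does (cyc? x (partner z) y) ⋆ w (partner z) ≡ - (does (cyc? x z y) ⋆ w z)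
    -- Blocks of weight zero may well be separated by the arc, but they contribute nothing.
    arc-skew z with toSum (w z ℤ.≟ 0ℤ)
    ... | inj₁ wz≡0 = begin
      does (cyc? x (partner z) y) ⋆ w (partner z) ≡⟨ cong (does (cyc? x (partner z) y) ⋆_) (trans (skew z) (cong -_ wz≡0)) ⟩
      does (cyc? x (partner z) y) ⋆ 0ℤ            ≡⟨ ⋆-zero (does (cyc? x (partner z) y)) ⟩
      0ℤ                                          ≡⟨ cong -_ (⋆-zero (does (cyc? x z y))) ⟨
      - (does (cyc? x z y) ⋆ 0ℤ)                  ≡⟨ cong (λ s → - (does (cyc? x z y) ⋆ s)) wz≡0 ⟨
      - (does (cyc? x z y) ⋆ w z)                 ∎
      where open ≡-Reasoning
    ... | inj₂ wz≢0 = trans (cong₂ _⋆_ (does-⇔ (mk⇔ back (inside z wz≢0)) (cyc? x (partner z) y) (cyc? x z y)) (skew z))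
                            (⋆-neg (does (cyc? x z y)) (w z))
      where
      back : Cyc x (partner z) y → Cyc x z y
      back c = subst (λ t → Cyc x t y) (partner-involutive z) (inside (partner z) (≢0-partner wz≢0) c)

least : {P : ℕ → Set} → (∀ n → Dec (P n)) → ∀ n → P n → ∃ λ m → P m × (∀ i → i ℕ.< m → ¬ P i)
least P? zero    pn = zero , pn , λ _ ()
least P? (suc n) pn with P? zero
... | yes p0 = zero , p0 , λ _ ()
... | no ¬p0 with m , pm , minimal ← least (P? ∘ suc) n pn =
  suc m , pm , λ { zero _ → ¬p0 ; (suc i) (ℕ.s<s i<m) → minimal i i<m }

module Composite {ℓ} (D : Pred ℕ ℓ) {U : Vec Color k} {M : Vec Color m} {L : Vec Color l}
                 {p : Partition M L} {p′ : Partition U M} (lv : Levelled p D) (lv′ : Levelled p′ D) where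

  open Composition p p′

  private
    module P  = Levelled lv
    module P′ = Levelled lv′
    module π  = Pairing P.pairing
    module π′ = Pairing P′.pairing

  partnerᵛ : Vertex → Vertex
  partnerᵛ = map-⊎ π′.partner π.partner

  partnerᵛ-involutive : ∀ x → partnerᵛ (partnerᵛ x) ≡ x
  partnerᵛ-involutive (inj₁ x) = cong inj₁ (π′.partner-involutive x)
  partnerᵛ-involutive (inj₂ x) = cong inj₂ (π.partner-involutive x)

  -- Fixing the outer points makes this a total involution and characterises them as its fixed
  -- points.
  glueᵛ : Vertex → Vertex
  glueᵛ (inj₁ (upper i)) = inj₁ (upper i)
  glueᵛ (inj₁ (lower i)) = inj₂ (upper i)
  glueᵛ (inj₂ (upper i)) = inj₁ (lower i)
  glueᵛ (inj₂ (lower j)) = inj₂ (lower j)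

  glueᵛ-involutive : ∀ x → glueᵛ (glueᵛ x) ≡ x
  glueᵛ-involutive (inj₁ (upper i)) = refl
  glueᵛ-involutive (inj₁ (lower i)) = refl
  glueᵛ-involutive (inj₂ (upper i)) = refl
  glueᵛ-involutive (inj₂ (lower j)) = refl

  IsOuter : Vertex → Set
  IsOuter x = glueᵛ x ≡ x

  _≟ᵛ_ : (x y : Vertex) → Dec (x ≡ y)
  _≟ᵛ_ = ≡-dec _≟ᵖ_ _≟ᵖ_

  outer-isOuter : ∀ α → IsOuter (outer α)
  outer-isOuter (upper i) = refl
  outer-isOuter (lower j) = refl

  isOuter⇒outer : ∀ x → IsOuter x → ∃ λ α → outer α ≡ x
  isOuter⇒outer (inj₁ (upper i)) _ = upper i , refl
  isOuter⇒outer (inj₂ (lower j)) _ = lower j , refl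

  outer-injective : ∀ {α β} → outer α ≡ outer β → α ≡ β
  outer-injective {upper _} {upper _} refl = refl
  outer-injective {lower _} {lower _} refl = refl

  connected-sym : ∀ {x y} → Connected x y → Connected y x
  connected-sym = EqC.symmetric Edge

  partnerᵛ-connected : ∀ x → Connected x (partnerᵛ x)
  partnerᵛ-connected (inj₁ x) = fwd (top (π′.∼-partner x)) ◅ ε
  partnerᵛ-connected (inj₂ x) = fwd (bottom (π.∼-partner x)) ◅ ε

  glueᵛ-connected : ∀ x → Connected x (glueᵛ x)
  glueᵛ-connected (inj₁ (upper i)) = ε
  glueᵛ-connected (inj₁ (lower i)) = fwd (glue i) ◅ ε
  glueᵛ-connected (inj₂ (upper i)) = bwd (glue i) ◅ ε
  glueᵛ-connected (inj₂ (lower j)) = ε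

  transport : (T : Vertex → Set) →
              (∀ {x y} → Edge x y → T x → T y) → (∀ {x y} → Edge x y → T y → T x) →
              ∀ {x y} → Connected x y → T x → T y
  transport T f g ε            t = t
  transport T f g (fwd e ◅ es) t = transport T f g es (f e t)
  transport T f g (bwd e ◅ es) t = transport T f g es (g e t)

  -- Every edge is a loop, a step of `partnerᵛ` or a step of `glueᵛ`, so a set closed under both
  -- involutions is a union of components.
  closed⇒connected : (T : Vertex → Set) → (∀ x → T x → T (partnerᵛ x)) → (∀ x → T x → T (glueᵛ x)) →
                     ∀ {x y} → Connected x y → T x → T y
  closed⇒connected T f g = transport T forth back
    where
    top-step : ∀ {α β} → p′ [ α ∼ β ] → T (inj₁ α) → T (inj₁ β)
    top-step r t with π′.∼⇒ r
    ... | inj₁ refl = t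
    ... | inj₂ refl = f _ t

    bottom-step : ∀ {α β} → p [ α ∼ β ] → T (inj₂ α) → T (inj₂ β)
    bottom-step r t with π.∼⇒ r
    ... | inj₁ refl = t
    ... | inj₂ refl = f _ t

    forth : ∀ {x y} → Edge x y → T x → T y
    forth (top r)    = top-step r
    forth (bottom r) = bottom-step r
    forth (glue i)   = g _

    back : ∀ {x y} → Edge x y → T y → T x
    back (top r)    = top-step (Partition.∼-sym p′ r)
    back (bottom r) = bottom-step (Partition.∼-sym p r)
    back (glue i)   = g _

  normalᵛ : Vertex → Color
  normalᵛ = [ normal U M , normal M L ]′

  normalᵛ-partner : ∀ x → normalᵛ (partnerᵛ x) ≡ flip (normalᵛ x)
  normalᵛ-partner (inj₁ x) = π′.opposed x
  normalᵛ-partner (inj₂ x) = π.opposed x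

  -- A glued point is lower in `p′` and upper in `p`, and normalization flips only the upper copy.
  normalᵛ-glue : ∀ x → ¬ IsOuter x → normalᵛ (glueᵛ x) ≡ flip (normalᵛ x)
  normalᵛ-glue (inj₁ (upper i)) ne = contradiction refl ne
  normalᵛ-glue (inj₁ (lower i)) ne = refl
  normalᵛ-glue (inj₂ (upper i)) ne = sym (flip-flip _)
  normalᵛ-glue (inj₂ (lower j)) ne = contradiction refl ne

  normal-outer : ∀ α → normalᵛ (outer α) ≡ normal U L α
  normal-outer (upper i) = refl
  normal-outer (lower j) = refl

  levelᵛ : Vertex → ℤ
  levelᵛ = [ pointLevel U M , pointLevel M L ]′

  level-outer : ∀ α → levelᵛ (outer α) ≡ pointLevel U L α
  level-outer (upper i) = refl
  level-outer (lower j) = refl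

  levelᵛ-edge : ∀ {x y} → Edge x y → levelᵛ x ≡ levelᵛ y
  levelᵛ-edge (top r)    = P′.∼⇒level≡ r
  levelᵛ-edge (bottom r) = P.∼⇒level≡ r
  levelᵛ-edge (glue i)   = refl

  levelᵛ-connected : ∀ {x y} → Connected x y → levelᵛ x ≡ levelᵛ y
  levelᵛ-connected {x} c = transport (λ y → levelᵛ x ≡ levelᵛ y)
    (λ e eq → trans eq (levelᵛ-edge e)) (λ e eq → trans eq (sym (levelᵛ-edge e))) c refl

  -- An injection into a finite ordinal, to which the pigeonhole principle applies.
  encode : Vertex → Fin ((k ℕ.+ m) ℕ.+ (m ℕ.+ l))
  encode = join (k ℕ.+ m) (m ℕ.+ l) ∘ map-⊎ (join k m) (join m l)

  encode-injective : ∀ {x y} → encode x ≡ encode y → x ≡ y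
  encode-injective {x} {y} e = trans (sym (decode-encode x)) (trans (cong decode e) (decode-encode y))
    where
    decode : Fin ((k ℕ.+ m) ℕ.+ (m ℕ.+ l)) → Vertex
    decode = map-⊎ (splitAt k) (splitAt m) ∘ splitAt (k ℕ.+ m)

    decode-encode : ∀ x → decode (encode x) ≡ x
    decode-encode x = trans
      (cong (map-⊎ (splitAt k) (splitAt m))
            (Fin.splitAt-join (k ℕ.+ m) (m ℕ.+ l) (map-⊎ (join k m) (join m l) x)))
      (parts x)
      where
      parts : ∀ x → map-⊎ (splitAt k) (splitAt m) (map-⊎ (join k m) (join m l) x) ≡ x
      parts (inj₁ x) = cong inj₁ (Fin.splitAt-join k m x)
      parts (inj₂ x) = cong inj₂ (Fin.splitAt-join m l x)

  -- The component of an outer point is the path that alternates between the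
  -- involutions partnerᵛ and glueᵛ until it meets a second outer point.
  module Path (α : Point k l) where

    -- Since `glueᵛ` fixes the outer start, the first step amounts to `partnerᵛ` alone.
    v : ℕ → Vertex
    v zero    = outer α
    v (suc n) = partnerᵛ (glueᵛ (v n))

    glue-v0 : glueᵛ (v zero) ≡ v zero
    glue-v0 = outer-isOuter α

    v-injective : ∀ i j → v (suc i) ≡ v (suc j) → v i ≡ v j
    v-injective i j e = trans (sym (unwind i)) (trans (cong (glueᵛ ∘ partnerᵛ) e) (unwind j))
      where
      unwind : ∀ i → glueᵛ (partnerᵛ (v (suc i))) ≡ v i
      unwind i = trans (cong glueᵛ (partnerᵛ-involutive (glueᵛ (v i)))) (glueᵛ-involutive (v i))

    -- Among more indices than vertices two collide. Both involutions can be undone, so the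
    -- collision moves back to the start `v zero`, which is outer.
    returns : ∃ λ n → IsOuter (v (suc n))
    returns with i , j , i<j , e ← Fin.pigeonhole (ℕ.n<1+n _) (encode ∘ v ∘ toℕ) =
      unshift (toℕ i) (toℕ j) i<j (encode-injective e)
      where
      unshift : ∀ i j → i ℕ.< j → v i ≡ v j → ∃ λ n → IsOuter (v (suc n))
      unshift zero    (suc j) _           e = j , trans (cong glueᵛ (sym e)) (trans glue-v0 e)
      unshift (suc i) (suc j) (ℕ.s<s i<j) e = unshift i j i<j (v-injective i j e)

    private
      -- The search begins at `v 1` because `v 0` is itself outer; the path ends at `v (suc N)`.
      first : ∃ λ n → IsOuter (v (suc n)) × (∀ i → i ℕ.< n → ¬ IsOuter (v (suc i)))
      first = least (λ n → glueᵛ (v (suc n)) ≟ᵛ v (suc n)) (proj₁ returns) (proj₂ returns)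

      N : ℕ
      N = proj₁ first

      vN-outer : IsOuter (v (suc N))
      vN-outer = proj₁ (proj₂ first)

      end∃ : ∃ λ β → outer β ≡ v (suc N)
      end∃ = isOuter⇒outer (v (suc N)) vN-outer

    end : Point k l
    end = proj₁ end∃

    end≡ : outer end ≡ v (suc N)
    end≡ = proj₂ end∃

    v-connected : ∀ n → Connected (outer α) (v n)
    v-connected zero    = ε
    v-connected (suc n) = v-connected n ◅◅ glueᵛ-connected (v n) ◅◅ partnerᵛ-connected (glueᵛ (v n))

    -- The first step flips the color once. Each later one flips it twice, as no outer point is met
    -- before the end.
    normalᵛ-v : ∀ i → i ℕ.≤ N → normalᵛ (v (suc i)) ≡ flip (normalᵛ (outer α))
    normalᵛ-v zero    _   = trans (normalᵛ-partner (glueᵛ (outer α))) (cong (flip ∘ normalᵛ) glue-v0)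
    normalᵛ-v (suc i) i<N = begin
      normalᵛ (v (suc (suc i)))          ≡⟨ normalᵛ-partner (glueᵛ (v (suc i))) ⟩
      flip (normalᵛ (glueᵛ (v (suc i)))) ≡⟨ cong flip (normalᵛ-glue (v (suc i)) (proj₂ (proj₂ first) i i<N)) ⟩
      flip (flip (normalᵛ (v (suc i))))  ≡⟨ flip-flip _ ⟩
      normalᵛ (v (suc i))                ≡⟨ normalᵛ-v i (ℕ.<⇒≤ i<N) ⟩
      flip (normalᵛ (outer α))           ∎
      where open ≡-Reasoning

    end-opposed : normal U L end ≡ flip (normal U L α)
    end-opposed = begin
      normal U L end               ≡⟨ normal-outer end ⟨
      normalᵛ (outer end)          ≡⟨ cong normalᵛ end≡ ⟩
      normalᵛ (v (suc N))          ≡⟨ normalᵛ-v N ℕ.≤-refl ⟩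
      flip (normalᵛ (outer α))     ≡⟨ cong flip (normal-outer α) ⟩
      flip (normal U L α)          ∎
      where open ≡-Reasoning

    -- The sequence `v` skips the vertices between a `glueᵛ` and a `partnerᵛ`; the second
    -- alternative restores them.
    OnPath : Vertex → Set
    OnPath x = ∃ λ i → i ℕ.≤ suc N × (x ≡ v i ⊎ x ≡ glueᵛ (v i))

    onPath-glue : ∀ x → OnPath x → OnPath (glueᵛ x)
    onPath-glue x (i , i≤ , inj₁ refl) = i , i≤ , inj₂ refl
    onPath-glue x (i , i≤ , inj₂ refl) = i , i≤ , inj₁ (glueᵛ-involutive (v i))

    onPath-partner : ∀ x → OnPath x → OnPath (partnerᵛ x)
    onPath-partner x (zero , _ , inj₁ refl) = 1 , ℕ.s≤s ℕ.z≤n , inj₁ (cong partnerᵛ (sym glue-v0))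
    onPath-partner x (suc i , i≤ , inj₁ refl) = i , ℕ.<⇒≤ i≤ , inj₂ (partnerᵛ-involutive (glueᵛ (v i)))
    onPath-partner x (i , i≤ , inj₂ refl) with ℕ.m≤n⇒m<n∨m≡n i≤
    ... | inj₁ i<   = suc i , i< , inj₁ refl
    -- At the end `glueᵛ` does nothing, so `partnerᵛ` leads back along the last step.
    ... | inj₂ refl = N , ℕ.n≤1+n N , inj₂ (trans (cong partnerᵛ vN-outer) (partnerᵛ-involutive (glueᵛ (v N))))

    onPath-outer : ∀ γ → OnPath (outer γ) → γ ≡ α ⊎ γ ≡ end
    onPath-outer γ (i , i≤ , e) = at i i≤ (direct e)
      where
      direct : outer γ ≡ v i ⊎ outer γ ≡ glueᵛ (v i) → outer γ ≡ v i
      direct (inj₁ e) = e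
      direct (inj₂ e) = trans (sym (outer-isOuter γ)) (trans (cong glueᵛ e) (glueᵛ-involutive (v i)))

      at : ∀ i → i ℕ.≤ suc N → outer γ ≡ v i → γ ≡ α ⊎ γ ≡ end
      at zero    _ e = inj₁ (outer-injective e)
      at (suc i) (ℕ.s≤s i≤N) e with ℕ.m≤n⇒m<n∨m≡n i≤N
      ... | inj₁ i<N  = contradiction (subst IsOuter e (outer-isOuter γ)) (proj₂ (proj₂ first) i i<N)
      ... | inj₂ refl = inj₂ (outer-injective (trans e (sym end≡)))

    -- The path is closed under both involutions and thus contains the whole component. Its only
    -- outer points are its two ends, which are distinct because their normalized colors are
    -- opposite.
    end-isBlock : PairBlock (p ∙ p′) α end
    end-isBlock = (λ e → flip-≢ (normal U L α) (trans (sym end-opposed) (cong (normal U L) (sym e)))) ,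
      λ γ → mk⇔ (λ c → onPath-outer γ (closed⇒connected OnPath onPath-partner onPath-glue c (zero , ℕ.z≤n , inj₁ refl)))
                λ { (inj₁ refl) → ε ; (inj₂ refl) → subst (Connected (outer α)) (sym end≡) (v-connected (suc N)) }

  pairing : Pairing (p ∙ p′)
  pairing = mkPairing (p ∙ p′) λ α → Path.end α , Path.end-isBlock α , Path.end-opposed α

  ∼⇒level≡ : ∀ {α β} → (p ∙ p′) [ α ∼ β ] → pointLevel U L α ≡ pointLevel U L β
  ∼⇒level≡ {α} {β} c = trans (sym (level-outer α)) (trans (levelᵛ-connected c) (level-outer β))

  -- Crossings in a composition

  module Weights (b′ : Point k l) where

    χ : Vertex → Bool
    χ x = does (connected? (outer b′) x)

    χ-cong : ∀ {x y} → Connected x y → χ x ≡ χ y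
    χ-cong {x} {y} c = does-⇔ (mk⇔ (_◅◅ c) (_◅◅ connected-sym c)) (connected? (outer b′) x) (connected? (outer b′) y)

    u : Fin k → ℤ
    u i = χ (inj₁ (upper i)) ⋆ signs U i

    mid : Fin m → ℤ
    mid i = χ (inj₁ (lower i)) ⋆ signs M i

    v : Fin l → ℤ
    v j = χ (inj₂ (lower j)) ⋆ signs L j

    top-weight : ∀ x → rowWeight u mid x ≡ χ (inj₁ x) ⋆ pointSign U M x
    top-weight (upper i) = sym (⋆-neg (χ (inj₁ (upper i))) (signs U i))
    top-weight (lower i) = refl

    -- The weights `mid` are read off the lower row of `p′`; the glue edges carry the indicator over
    -- to the upper row of `p`.
    bottom-weight : ∀ x → rowWeight mid v x ≡ χ (inj₂ x) ⋆ pointSign M L x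
    bottom-weight (upper i) = trans (sym (⋆-neg (χ (inj₁ (lower i))) (signs M i)))
                                    (cong (_⋆ (- signs M i)) (χ-cong (glueᵛ-connected (inj₁ (lower i)))))
    bottom-weight (lower j) = refl

    outer-weight : ∀ x → rowWeight u v x ≡ χ (outer x) ⋆ pointSign U L x
    outer-weight (upper i) = sym (⋆-neg (χ (inj₁ (upper i))) (signs U i))
    outer-weight (lower j) = refl

    -- Partners lie in the same component and have opposite signs.
    top-skew : ∀ x → rowWeight u mid (π′.partner x) ≡ - rowWeight u mid x
    top-skew x = begin
      rowWeight u mid (π′.partner x) ≡⟨ top-weight (π′.partner x) ⟩
      χ (inj₁ (π′.partner x)) ⋆ pointSign U M (π′.partner x)
        ≡⟨ cong₂ _⋆_ (sym (χ-cong (partnerᵛ-connected (inj₁ x)))) (π′.pointSign-skew x) ⟩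
      χ (inj₁ x) ⋆ (- pointSign U M x) ≡⟨ ⋆-neg (χ (inj₁ x)) (pointSign U M x) ⟩
      - (χ (inj₁ x) ⋆ pointSign U M x) ≡⟨ cong -_ (top-weight x) ⟨
      - rowWeight u mid x              ∎
      where open ≡-Reasoning

    bottom-skew : ∀ x → rowWeight mid v (π.partner x) ≡ - rowWeight mid v x
    bottom-skew x = begin
      rowWeight mid v (π.partner x) ≡⟨ bottom-weight (π.partner x) ⟩
      χ (inj₂ (π.partner x)) ⋆ pointSign M L (π.partner x)
        ≡⟨ cong₂ _⋆_ (sym (χ-cong (partnerᵛ-connected (inj₂ x)))) (π.pointSign-skew x) ⟩
      χ (inj₂ x) ⋆ (- pointSign M L x) ≡⟨ ⋆-neg (χ (inj₂ x)) (pointSign M L x) ⟩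
      - (χ (inj₂ x) ⋆ pointSign M L x) ≡⟨ cong -_ (bottom-weight x) ⟨
      - rowWeight mid v x             ∎
      where open ≡-Reasoning

    u≡v : sum u ≡ sum v
    u≡v = trans (π′.skew⇒sum≡ u mid top-skew) (π.skew⇒sum≡ mid v bottom-skew)

    -- Leaving `s` and `t` open lets this serve the weights of `p′`, of `p` and of the composite
    -- alike.
    weight≡0 : ∀ x {s t} → s ≡ χ x ⋆ t → ¬ Connected (outer b′) x → s ≡ 0ℤ
    weight≡0 x {t = t} e ¬c = trans e (cong (_⋆ t) (dec-false (connected? (outer b′) x) ¬c))

    weight≢0⇒ : ∀ x {s t} → s ≡ χ x ⋆ t → s ≢ 0ℤ → Connected (outer b′) x
    weight≢0⇒ x e s≢0 = decidable-stable (connected? (outer b′) x) (s≢0 ∘ weight≡0 x e)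

    -- Both copies of a middle point read the prefix of `mid`, so glue edges preserve this by
    -- definition.
    potential : Vertex → ℤ
    potential = [ rowPrefix u mid , rowPrefix mid v ]′

    potential-outer : ∀ α → potential (outer α) ≡ rowPrefix u v α
    potential-outer (upper i) = refl
    potential-outer (lower j) = refl

    module _ {b : Point k l} (apart : ¬ Connected (outer b) (outer b′))
             (D∋d : D ∣ pointLevel U L b′ - pointLevel U L b ∣) where

      private
        -- Levels are constant on components, so the forbidden distance occurs between any two
        -- vertices on the two paths. By `avoids`, no block on one path then crosses a block on the
        -- other inside `p` or `p′`.
        d-on : ∀ {x z} → Connected (outer b) x → Connected (outer b′) z → D ∣ levelᵛ z - levelᵛ x ∣
        d-on {x} {z} c c′ = subst₂ (λ s t → D ∣ t - s ∣)
          (trans (sym (level-outer b)) (levelᵛ-connected c)) (trans (sym (level-outer b′)) (levelᵛ-connected c′)) D∋d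

        apart-from : ∀ {x} → Connected (outer b) x → ¬ Connected (outer b′) x
        apart-from c c′ = apart (c ◅◅ connected-sym c′)

        -- The block of `x` lies off the path of `b′` and has weight zero, while every point of
        -- nonzero weight lies on that path. So the block is uncrossed by all weighted blocks.
        top-step : ∀ {x y} → Connected (outer b) (inj₁ x) → p′ [ x ∼ y ] → rowPrefix u mid y ≡ rowPrefix u mid x
        top-step {x} c r = rowPrefix-constant P′.pairing u mid top-skew r
          (weight≡0 (inj₁ x) (top-weight x) (apart-from c))
          λ z wz≢0 cross → P′.avoids cross (d-on c (weight≢0⇒ (inj₁ z) (top-weight z) wz≢0))

        bottom-step : ∀ {x y} → Connected (outer b) (inj₂ x) → p [ x ∼ y ] → rowPrefix mid v y ≡ rowPrefix mid v x
        bottom-step {x} c r = rowPrefix-constant P.pairing mid v bottom-skew r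
          (weight≡0 (inj₂ x) (bottom-weight x) (apart-from c))
          λ z wz≢0 cross → P.avoids cross (d-on c (weight≢0⇒ (inj₂ z) (bottom-weight z) wz≢0))

        edge-step : ∀ {x y} → Connected (outer b) x → Edge x y → potential y ≡ potential x
        edge-step c (top r)    = top-step c r
        edge-step c (bottom r) = bottom-step c r
        edge-step c (glue i)   = refl

      potential-constant : ∀ {x} → Connected (outer b) x → potential x ≡ potential (outer b)
      -- Connectedness to `b` is carried along because each single step depends on it.
      potential-constant c = proj₂ (transport (λ x → Connected (outer b) x × potential x ≡ potential (outer b))
        (λ { e (c , eq) → c ◅◅ fwd e ◅ ε , trans (edge-step c e) eq })
        (λ { e (c , eq) → c ◅◅ bwd e ◅ ε , trans (sym (edge-step (c ◅◅ bwd e ◅ ε) e)) eq })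
        c (ε , refl))

      -- The weights on the arc ]α,β[ cancel, but only γ contributes to them.
      uncrossed : ¬ Cross (p ∙ p′) b b′
      uncrossed (_ , α , β , γ , δ , bα , bβ , b′γ , b′δ , αγβ , βδα) = wγ≢0 (begin
        w γ                                 ≡⟨ ∑ᵖ-single w γ ⟨
        ∑ᵖ (λ x → does (x ≟ᵖ γ) ⋆ w x)      ≡⟨ ∑ᵖ-cong only-γ ⟨
        ∑arc w α β                          ≡⟨ arc≡0 ⟩
        0ℤ                                  ∎)
        where
        open ≡-Reasoning
        open Pairing pairing using (∼⇒)

        w : Point k l → ℤ
        w = rowWeight u v

        cγ : Cyc α γ β
        cγ = Equivalence.from (Cyc⇔arc α γ β) αγβ

        cδ : Cyc β δ α
        cδ = Equivalence.from (Cyc⇔arc β δ α) βδα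

        α≢β : α ≢ β
        -- If the ends coincided, the arc would be its own complementary arc.
        α≢β refl = Cyc-asym cγ cγ

        same-prefix : rowPrefix u v α ≡ rowPrefix u v β
        same-prefix = begin
          rowPrefix u v α    ≡⟨ potential-outer α ⟨
          potential (outer α) ≡⟨ potential-constant bα ⟩
          potential (outer b) ≡⟨ potential-constant bβ ⟨
          potential (outer β) ≡⟨ potential-outer β ⟩
          rowPrefix u v β    ∎

        arc≡0 : ∑arc w α β ≡ 0ℤ
        arc≡0 = identityˡ-unique (∑arc w α β) (rowPrefix u v α) (trans
          (∑arc+rowPrefix u v u≡v α β α≢β
            (weight≡0 (outer α) (outer-weight α) (apart-from bα)) (weight≡0 (outer β) (outer-weight β) (apart-from bβ)))
          (sym same-prefix))

        block : ∀ x → Connected (outer b′) (outer x) → x ≡ γ ⊎ x ≡ δ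
        block x c with ∼⇒ {γ} {x} (connected-sym b′γ ◅◅ c) | ∼⇒ {γ} {δ} (connected-sym b′γ ◅◅ b′δ)
        ... | inj₁ e | _         = inj₁ e
        -- `γ` and `δ` lie on complementary arcs and are therefore the two distinct points of their
        -- block.
        ... | inj₂ _ | inj₁ refl = contradiction cδ (Cyc-asym cγ)
        ... | inj₂ e | inj₂ e′   = inj₂ (trans e (sym e′))

        only-γ : ∀ x → does (cyc? α x β) ⋆ w x ≡ does (x ≟ᵖ γ) ⋆ w x
        only-γ x with toSum (connected? (outer b′) (outer x))
        ... | inj₂ ¬c rewrite weight≡0 (outer x) (outer-weight x) ¬c =
          trans (⋆-zero (does (cyc? α x β))) (sym (⋆-zero (does (x ≟ᵖ γ))))
        ... | inj₁ c = cong (_⋆ w x) (does-⇔ (mk⇔ to (λ { refl → cγ })) (cyc? α x β) (x ≟ᵖ γ))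
          where
          to : Cyc α x β → x ≡ γ
          to cx with block x c
          ... | inj₁ e    = e
          -- The other weighted point `δ` lies on the complementary arc.
          ... | inj₂ refl = contradiction cδ (Cyc-asym cx)

        wγ≢0 : w γ ≢ 0ℤ
        wγ≢0 e = sgn≢0 (normal U L γ) (begin
          sgn (normal U L γ)             ≡⟨ pointSign≡ U L γ ⟨
          true ⋆ pointSign U L γ         ≡⟨ cong (_⋆ pointSign U L γ) (dec-true (connected? (outer b′) (outer γ)) b′γ) ⟨
          χ (outer γ) ⋆ pointSign U L γ  ≡⟨ outer-weight γ ⟨
          w γ                            ≡⟨ e ⟩
          0ℤ                             ∎)
          where
          sgn≢0 : ∀ c → sgn c ≢ 0ℤ
          sgn≢0 ○ ()
          sgn≢0 ● ()

  composite-levelled : Levelled (p ∙ p′) D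
  composite-levelled = record
    { pairing  = pairing
    ; ∼⇒level≡ = λ {α} {β} → ∼⇒level≡ {α} {β}
    -- The assumption that the distance lies in `D` is what rules out the crossing.
    ; avoids   = λ {b} {b′} cross D∋d → Weights.uncrossed b′ {b} (proj₁ cross) D∋d cross
    }

theorem1 : ∀ {ℓ} (D : Pred ℕ ℓ) → IsSubsemigroup D → IsCategory (𝓘 D)
theorem1 D _ = record
  { resp-≈   = λ {_} {_} {_} {_} {p} {q} p≈q p∈ → Levelled⇒𝓘 q (Levelled-≈ D p≈q (𝓘⇒Levelled p p∈))
  ; ⊗-closed = λ {_} {_} {_} {_} {_} {_} {_} {_} {p} {p′} p∈ p′∈ →
      Levelled⇒𝓘 (p ⊗ p′) (Tensor.tensor D (𝓘⇒Levelled p p∈) (𝓘⇒Levelled p′ p′∈))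
  ; ∙-closed = λ {_} {_} {_} {_} {_} {_} {p} {p′} p∈ p′∈ →
      Levelled⇒𝓘 (p ∙ p′) (Composite.composite-levelled D (𝓘⇒Levelled p p∈) (𝓘⇒Levelled p′ p′∈))
  ; *-closed = λ {_} {_} {_} {_} {p} p∈ → Levelled⇒𝓘 (p *) (Involution.involution D (𝓘⇒Levelled p p∈))
  ; identity = λ x → Levelled⇒𝓘 _ (identity-levelled D x)
  ; pair-○●  = Levelled⇒𝓘 _ (○●-levelled D)
  ; pair-●○  = Levelled⇒𝓘 _ (●○-levelled D)
  }
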